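{- For every $n\geq 4$, the generalized $4$-connectivity of the $n$-dimensional dual cube satisfies $\kappa_4(D_n)=n-1$.
   Context: The $n$-dimensional dual cube $D_n$ has vertex set all binary strings $u_1u_2\cdots u_{2n-1}$ of length $2n-1$; two vertices $u,v$ are adjacent iff they differ in exactly one bit position $i$, and either $1\leq i\leq n-1$ and $u_{2n-1}=v_{2n-1}=0$, or $n\leq i\leq 2n-2$ and $u_{2n-1}=v_{2n-1}=1$, or $i=2n-1$. For a graph $G$ and $S\subseteq V(G)$, $\kappa_G(S)$ is the maximum number $k$ of pairwise edge-disjoint trees $T_1,\dots,T_k$ in $G$, each containing $S$, such that $V(T_i)\cap V(T_j)=S$ for all $i\neq j$. For an integer $r\geq 2$, the generalized $r$-connectivity is $\kappa_r(G)=\min\{\kappa_G(S): S\subseteq V(G),\ |S|=r\}$. -}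

module Defs where

open import Data.Nat using (ℕ; suc; _*_; _∸_; _<_; _≤_; _≥_)
open import Data.Bool using (Bool; true; false)
open import Data.Fin using (Fin; toℕ)
open import Data.Vec using (Vec; lookup; last)
open import Data.List using (List; []; _∷_; length)
open import Data.List.Membership.Propositional using (_∈_)
open import Data.List.Relation.Unary.Unique.Propositional using (Unique)
open import Data.Product using (_×_; _,_; Σ; ∃; proj₁; proj₂)
open import Data.Sum using (_⊎_)
open import Relation.Nullary using (¬_)
open import Relation.Binary.PropositionalEquality using (_≡_; _≢_)
open import Relation.Binary.Construct.Closure.ReflexiveTransitive using (Star)

-- The n-dimensional dual cube D_n.
-- Vertices: binary strings u₁…u_{2n-1}, represented as Vec Bool (2(n-1)+1)
-- (= 2n-1 for n ≥ 1).  Position i (1-based) corresponds to the index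
-- j : Fin _ with toℕ j = i - 1; the last bit u_{2n-1} is `last u`.

DVert : ℕ → Set
DVert n = Vec Bool (suc (2 * (n ∸ 1)))

DiffExactlyAt : ∀ {m} → Vec Bool m → Vec Bool m → Fin m → Set
DiffExactlyAt u v j = (lookup u j ≢ lookup v j) × (∀ k → k ≢ j → lookup u k ≡ lookup v k)

DAdj : (n : ℕ) → DVert n → DVert n → Set
DAdj n u v = Σ (Fin (suc (2 * (n ∸ 1)))) λ j → DiffExactlyAt u v j ×
  (   (toℕ j < n ∸ 1 × last u ≡ false × last v ≡ false)
    ⊎ ((n ∸ 1 ≤ toℕ j × toℕ j < 2 * (n ∸ 1)) × last u ≡ true × last v ≡ true)
    ⊎ toℕ j ≡ 2 * (n ∸ 1) )

module _ {V : Set} (Adj : V → V → Set) where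

  -- a finite subgraph of G: vertex list and edge list (edges as ordered
  -- pairs, read as unordered edges), all edges being edges of G
  record Subgraph : Set where
    field
      verts   : List V
      edges   : List (V × V)
      edgeAdj : ∀ {u v} → (u , v) ∈ edges → Adj u v
      edgeIn  : ∀ {u v} → (u , v) ∈ edges → u ∈ verts × v ∈ verts

  open Subgraph public

  HasEdge : Subgraph → V → V → Set
  HasEdge H u v = ((u , v) ∈ edges H) ⊎ ((v , u) ∈ edges H)

  Connected : Subgraph → Set
  Connected H = ∀ {u v} → u ∈ verts H → v ∈ verts H → Star (HasEdge H) u v

  PathEdges : Subgraph → V → List V → Set
  PathEdges H x [] = Data.Unit.⊤ where import Data.Unit
  PathEdges H x (y ∷ ys) = HasEdge H x y × PathEdges H y ys

  record Cycle (H : Subgraph) : Set where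
    field
      x₀     : V
      rest   : List V
      long   : 2 ≤ length rest
      uniq   : Unique (x₀ ∷ rest)
      path   : PathEdges H x₀ (rest Data.List.++ (x₀ ∷ []))

  IsTree : Subgraph → Set
  IsTree H = Connected H × ¬ Cycle H

  record Tree : Set where
    field
      graph  : Subgraph
      isTree : IsTree graph

  open Tree public

  record InternallyDisjointSTrees (S : List V) (k : ℕ) : Set where
    field
      tree      : Fin k → Tree
      containsS : ∀ i {x} → x ∈ S → x ∈ verts (graph (tree i))
      edgeDisj  : ∀ i j → i ≢ j → ∀ {u v} →
                  HasEdge (graph (tree i)) u v → ¬ HasEdge (graph (tree j)) u v
      vertDisj  : ∀ i j → i ≢ j → ∀ {x} →
                  x ∈ verts (graph (tree i)) → x ∈ verts (graph (tree j)) → x ∈ S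

  κS≡ : List V → ℕ → Set
  κS≡ S k = InternallyDisjointSTrees S k × ¬ InternallyDisjointSTrees S (suc k)

  -- κ_r(G) = k: min over r-subsets S of κ_G(S) equals k
  -- (every r-set S admits k internally disjoint S-trees, and some r-set S
  -- has κ_G(S) = k)
  κr≡ : ℕ → ℕ → Set
  κr≡ r k = (∀ (S : List V) → Unique S → length S ≡ r → InternallyDisjointSTrees S k)
          × ∃ λ (S : List V) → Unique S × length S ≡ r × κS≡ S k

module Submission where

-- Upper bound: if S contains two adjacent vertices x and y, then n trees would use all
-- n edges at x and all n edges at y, so the tree through the edge xy could not leave
-- {x , y}.
--
-- Lower bound: put m = n − 1.  The dual cube consists of 2 · 2^m clusters, each an
-- m-cube, with exactly one edge between any two clusters of opposite classes.  Colour
-- the vertices outside S, and the edges within S, with m colours; the i-th tree is taken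
-- inside colour i together with S, so disjointness is automatic and only connectedness
-- matters.  A cluster avoiding S gets a single colour, and clusters of the same colour
-- are linked through the edges between opposite classes.  A point alone in its cluster
-- reaches all colours along the m disjoint paths to a centre o whose neighbours face
-- clusters of all colours.  Several points of S in one cluster rather use the clusters
-- facing themselves and their neighbours; this asks for a labelling of the m-cube with m
-- colours in which each of at most four points meets every colour, also counting the
-- edges within S.  Such labellings are built by splitting the cube along its first bit.

open import Defs
open import Data.Bool using (Bool; true; false; not; _xor_; if_then_else_)
open import Data.Bool.Properties using (not-involutive; ¬-not) renaming (_≟_ to _≟ᵇ_)
open import Data.Empty using (⊥)
open import Data.Fin using (Fin; zero; suc; toℕ; inject₁; fromℕ; _↑ˡ_; _↑ʳ_; punchOut)
open import Data.Fin.Permutation.Components using (transpose; transpose-inverse)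
open import Data.Fin.Properties
  using (any?; all?; suc-injective; injective⇒≤; toℕ-inject₁; toℕ-fromℕ; toℕ-↑ˡ; toℕ-↑ʳ; toℕ<n;
         join-splitAt; punchOut-injective)
  renaming (_≟_ to _≟ᶠ_)
open import Data.Fin.Relation.Unary.Top using (view; ‵fromℕ; ‵inject₁)
open import Data.List using (List; []; _∷_; _++_; length; map)
open import Data.List.Membership.Propositional using (_∈_; _∉_; find; lose)
open import Data.List.Membership.Propositional.Properties using (∈-map⁺; ∈-map⁻; ∈-++⁻)
open import Data.List.Properties using (length-map)
open import Data.List.Relation.Binary.Permutation.Propositional using (_↭_; prep; swap; ↭-sym; ↭⇒↭ₛ)
open import Data.List.Relation.Binary.Permutation.Propositional.Properties
  using (∈-resp-↭; ++-comm; shift)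
open import Data.List.Relation.Unary.All using (All; []; _∷_)
open import Data.List.Relation.Unary.All.Properties using (¬Any⇒All¬)
open import Data.List.Relation.Unary.AllPairs using ([]; _∷_)
open import Data.List.Relation.Unary.Any using (Any; here; there)
open import Data.List.Relation.Unary.Unique.DecPropositional using (unique?)
open import Data.List.Relation.Unary.Unique.Propositional using (Unique)
open import Data.Nat using (ℕ; zero; suc; pred; _+_; _*_; _∸_; _≤_; _<_; _≥_; z≤n; s≤s)
open import Data.Nat.Properties
  using (<⇒≢; <⇒≱; ≤-refl; ≤-trans; ≤-pred; <-≤-trans; m≤m+n; m≤n⇒m≤1+n; 1+n≰n; +-suc;
         +-identityʳ; +-monoʳ-<)
open import Data.Product using (Σ; ∃; ∃₂; _×_; _,_; proj₁; proj₂)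
open import Data.Sum using (_⊎_; inj₁; inj₂; [_,_]′)
open import Data.Vec using (Vec; []; _∷_; lookup; _∷ʳ_; last; initLast)
open import Data.Vec.Properties using (≡-dec; last-∷ʳ; ∷ʳ-injective; ++-injective)
open import Function using (_∘_; id)
open import Relation.Binary.Construct.Closure.ReflexiveTransitive
  using (Star; ε; _◅_; _◅◅_; gmap; reverse)
open import Relation.Binary.Definitions using (DecidableEquality)
open import Relation.Binary.PropositionalEquality
  using (_≡_; _≢_; refl; sym; trans; cong; cong₂; subst; subst₂; setoid)
open import Relation.Nullary using (¬_; Dec; yes; no; contradiction)
open import Relation.Nullary.Decidable using (¬?; _×-dec_; toWitness)
import Data.Fin as F
import Data.List.Membership.DecPropositional as DecMembership
import Data.List.Relation.Binary.Permutation.Propositional as Permutation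
import Data.List.Relation.Binary.Permutation.Setoid.Properties as PermutationSetoid
import Data.List.Relation.Unary.All as All
import Data.List.Relation.Unary.Any as Any
import Data.List.Relation.Unary.Unique.Propositional.Properties as Unique
import Data.Vec as Vec

-- Position `w` of any cluster faces cluster `w` of the other class. So labelling the positions of
-- one class is the same as colouring the clusters of the other class, and one labelling has to
-- serve all clusters of a class at once. This is why a labelling made for one crowded cluster must
-- often also suit the centre of the paths in another. A point can leave its cluster at itself or at
-- one of its m neighbours: m + 1 exits for m colours, so just one to spare. Each neighbour that
-- lies in S costs an exit, and the edges within S have to make up for it; the delicate cases are
-- those where points of S are adjacent or have common neighbours. Three routing schemes cover all
-- distributions of S: S within one class; the points of one class in a single cluster and those of
-- the other class in distinct clusters; every cluster with at most two points, grouped around one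
-- centre for each class. The bound on n enters as m at least 3: then four clusters can be discarded
-- and m remain, and some position is adjacent to none of three given ones.

Q : ℕ → Set
Q m = Vec Bool m

-- Bit flips, parity and directions in the hypercube

infixl 6 _⊕_

_⊕_ : ∀ {m} → Q m → Fin m → Q m
(b ∷ p) ⊕ zero  = not b ∷ p
(b ∷ p) ⊕ suc j = b ∷ p ⊕ j

_≟_ : ∀ {m} → DecidableEquality (Q m)
_≟_ = ≡-dec _≟ᵇ_

⊕-involutive : ∀ {m} (p : Q m) j → p ⊕ j ⊕ j ≡ p
⊕-involutive (b ∷ p) zero    = cong (_∷ p) (not-involutive b)
⊕-involutive (b ∷ p) (suc j) = cong (b ∷_) (⊕-involutive p j)

⊕-comm : ∀ {m} (p : Q m) i j → p ⊕ i ⊕ j ≡ p ⊕ j ⊕ i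
⊕-comm (b ∷ p) zero    zero    = refl
⊕-comm (b ∷ p) zero    (suc j) = refl
⊕-comm (b ∷ p) (suc i) zero    = refl
⊕-comm (b ∷ p) (suc i) (suc j) = cong (b ∷_) (⊕-comm p i j)

⊕-sym : ∀ {m} {p q : Q m} j → q ≡ p ⊕ j → p ≡ q ⊕ j
⊕-sym {p = p} j refl = sym (⊕-involutive p j)

lookup-⊕ : ∀ {m} (p : Q m) j → lookup (p ⊕ j) j ≡ not (lookup p j)
lookup-⊕ (b ∷ p) zero    = refl
lookup-⊕ (b ∷ p) (suc j) = lookup-⊕ p j

lookup-⊕-≢ : ∀ {m} (p : Q m) {i j} → i ≢ j → lookup (p ⊕ j) i ≡ lookup p i
lookup-⊕-≢ (b ∷ p) {zero}  {zero}  ne = contradiction refl ne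
lookup-⊕-≢ (b ∷ p) {zero}  {suc j} ne = refl
lookup-⊕-≢ (b ∷ p) {suc i} {zero}  ne = refl
lookup-⊕-≢ (b ∷ p) {suc i} {suc j} ne = lookup-⊕-≢ p (ne ∘ cong suc)

not-≢ : ∀ {b} → not b ≢ b
not-≢ {true}  ()
not-≢ {false} ()

⊕-≢ : ∀ {m} (p : Q m) j → p ⊕ j ≢ p
⊕-≢ p j e = not-≢ (trans (sym (lookup-⊕ p j)) (cong (λ q → lookup q j) e))

⊕-injective : ∀ {m} (p : Q m) {i j} → p ⊕ i ≡ p ⊕ j → i ≡ j
⊕-injective p {i} {j} e with i ≟ᶠ j
... | yes i≡j = i≡j
... | no  i≢j = contradiction
  (trans (sym (lookup-⊕ p i)) (trans (cong (λ q → lookup q i) e) (lookup-⊕-≢ p i≢j))) not-≢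

-- If `a` were neither `c` nor `d`, bit `a` would be kept on the right; on the left it is flipped
-- exactly once, because `a ≢ b`.
⊕⊕-injective : ∀ {m} (p : Q m) {a b c d} → a ≢ b → p ⊕ a ⊕ b ≡ p ⊕ c ⊕ d → a ≡ c ⊎ a ≡ d
⊕⊕-injective p {a} {b} {c} {d} a≢b e with a ≟ᶠ c | a ≟ᶠ d
... | yes a≡c | _       = inj₁ a≡c
... | no  _   | yes a≡d = inj₂ a≡d
... | no  a≢c | no  a≢d = contradiction
  (trans (sym (trans (lookup-⊕-≢ (p ⊕ a) a≢b) (lookup-⊕ p a)))
    (trans (cong (λ q → lookup q a) e) (trans (lookup-⊕-≢ (p ⊕ c) a≢d) (lookup-⊕-≢ p a≢c))))
  not-≢

parity : ∀ {m} → Q m → Bool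
parity []      = false
parity (b ∷ p) = b xor parity p

parity-⊕ : ∀ {m} (p : Q m) j → parity (p ⊕ j) ≡ not (parity p)
parity-⊕ (true  ∷ p) zero    = sym (not-involutive (parity p))
parity-⊕ (false ∷ p) zero    = refl
parity-⊕ (true  ∷ p) (suc j) = cong not (parity-⊕ p j)
parity-⊕ (false ∷ p) (suc j) = parity-⊕ p j

⊕-parity-≢ : ∀ {m} {p q : Q m} j → parity p ≡ parity q → p ⊕ j ≢ q
⊕-parity-≢ {p = p} {q} j same e =
  not-≢ (trans (sym (parity-⊕ p j)) (trans (cong parity e) (sym same)))

-- Most colourings below are nested `pick`s, so `pick-yes` and `pick-no` evaluate them without
-- splitting on the decisions.
pick : ∀ {A B : Set} → Dec A → B → B → B
pick (yes _) x y = x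
pick (no _)  x y = y

pick-yes : ∀ {A B : Set} (d : Dec A) {x y : B} → A → pick d x y ≡ x
pick-yes (yes _) a = refl
pick-yes (no ¬a) a = contradiction a ¬a

pick-no : ∀ {A B : Set} (d : Dec A) {x y : B} → ¬ A → pick d x y ≡ y
pick-no (yes a) ¬a = contradiction a ¬a
pick-no (no _)  ¬a = refl

Edge : ∀ {m} → Q m → Q m → Set
Edge p q = ∃ λ j → q ≡ p ⊕ j

neighbour? : ∀ {m} (p q : Q m) → Dec (Edge p q)
neighbour? p q = any? λ j → q ≟ (p ⊕ j)

lift : ∀ {m} → Fin (suc m) → Fin (suc (suc m))
lift zero    = zero
lift (suc j) = suc (suc j)

-- The first difference, shifted by one; zero if the arguments are equal.
direction : ∀ {m} → Q m → Q m → Fin (suc m)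
direction []      []      = zero
direction (a ∷ p) (b ∷ q) = if a xor b then suc zero else lift (direction p q)

direction-refl : ∀ {m} (p : Q m) → direction p p ≡ zero
direction-refl []          = refl
direction-refl (true  ∷ p) = cong lift (direction-refl p)
direction-refl (false ∷ p) = cong lift (direction-refl p)

direction-⊕ : ∀ {m} (p : Q m) j → direction p (p ⊕ j) ≡ suc j
direction-⊕ (true  ∷ p) zero    = refl
direction-⊕ (false ∷ p) zero    = refl
direction-⊕ (true  ∷ p) (suc j) = cong lift (direction-⊕ p j)
direction-⊕ (false ∷ p) (suc j) = cong lift (direction-⊕ p j)

direction-⊕ˡ : ∀ {m} (p : Q m) j → direction (p ⊕ j) p ≡ suc j
direction-⊕ˡ p j =
  trans (cong (direction (p ⊕ j)) (sym (⊕-involutive p j))) (direction-⊕ (p ⊕ j) j)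

cube-connected : ∀ {m} (p q : Q m) → Star Edge p q
cube-connected []      []      = ε
cube-connected (a ∷ p) (b ∷ q) with a ≟ᵇ b
... | yes refl = gmap (a ∷_) (λ (j , e) → suc j , cong (a ∷_) e) (cube-connected p q)
... | no  a≢b  = (zero , cong (_∷ p) (¬-not (a≢b ∘ sym))) ◅
  gmap (b ∷_) (λ (j , e) → suc j , cong (b ∷_) e) (cube-connected p q)

-- Trees grown along walks

module _ {V : Set} (Adj : V → V → Set) where

  -- A family of trees weakened to symmetric edge relations joined up by walks. `Step` and `In` are
  -- predicates, so that no colour class has to be listed; only what the walks visit enters a tree.
  record Routing (S : List V) (k : ℕ) : Set₁ where
    field
      Step     : Fin k → V → V → Set
      In       : Fin k → V → Set
      step-adj : ∀ {i u v} → Step i u v → Adj u v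
      step-in  : ∀ {i u v} → Step i u v → In i v
      step-sym : ∀ {i u v} → Step i u v → Step i v u
      step-one : ∀ {i j u v} → Step i u v → Step j u v → i ≡ j
      in-S     : ∀ {i x} → x ∈ S → In i x
      in-one   : ∀ {i j x} → In i x → In j x → i ≢ j → x ∈ S
      walk     : ∀ i {x y} → x ∈ S → y ∈ S → Star (Step i) x y

∈-map-injective : ∀ {A B : Set} (g : A → B) (f : B → A) → (∀ x → f (g x) ≡ x) →
                  ∀ {S x} → g x ∈ map g S → x ∈ S
∈-map-injective g f fg {S} {x} gx∈ with ∈-map⁻ g gx∈
... | y , y∈ , e = subst (_∈ S) (trans (sym (fg y)) (trans (cong f (sym e)) (fg x))) y∈

module _ {V W : Set} {AdjV : V → V → Set} {AdjW : W → W → Set} where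

  Routing-transport : (f : V → W) (g : W → V) → (∀ w → f (g w) ≡ w) → (∀ v → g (f v) ≡ v) →
    (∀ {u v} → AdjV (g u) (g v) → AdjW u v) →
    ∀ {S k} → Routing AdjV (map g S) k → Routing AdjW S k
  Routing-transport f g fg gf adj {S} r = record
    { Step = λ i u v → Step i (g u) (g v)
    ; In = λ i u → In i (g u)
    ; step-adj = adj ∘ step-adj ; step-in = step-in ; step-sym = step-sym ; step-one = step-one
    ; in-S = in-S ∘ ∈-map⁺ g
    ; in-one = λ a b n → ∈-map-injective g f fg (in-one a b n)
    ; walk = λ i {x} {y} x∈ y∈ → subst₂ (Star _) (fg x) (fg y)
        (gmap f (λ {a} {b} → subst₂ (Step i) (sym (gf a)) (sym (gf b)))
          (walk i (∈-map⁺ g x∈) (∈-map⁺ g y∈)))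
    }
    where
    open Routing r

module _ {V : Set} {Adj : V → V → Set} where

  PathEdges-last : ∀ (H : Subgraph Adj) x y l {z} → PathEdges Adj H x ((y ∷ l) ++ z ∷ []) →
                   ∃ λ a → a ∈ y ∷ l × HasEdge Adj H a z
  PathEdges-last H x y []      (_ , e , _) = y , here refl , e
  PathEdges-last H x y (c ∷ l) (_ , p) with PathEdges-last H y c l p
  ... | a , a∈ , e = a , there a∈ , e

  HasEdge-sym : ∀ (H : Subgraph Adj) {x y} → HasEdge Adj H x y → HasEdge Adj H y x
  HasEdge-sym H (inj₁ e) = inj₂ e
  HasEdge-sym H (inj₂ e) = inj₁ e

  TwoNeighbours : Subgraph Adj → V → Set
  TwoNeighbours H y = ∃₂ λ a b → a ≢ b × HasEdge Adj H y a × HasEdge Adj H y b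

  -- The neighbours are the predecessor and the successor on the path. They coincide only if `x`
  -- equals `z` with a single vertex in between, which the disjunction excludes.
  path-interior : ∀ (H : Subgraph Adj) x l {z} → PathEdges Adj H x (l ++ z ∷ []) →
    Unique (x ∷ l) → z ∉ l → x ≢ z ⊎ 2 ≤ length l → ∀ {y} → y ∈ l → TwoNeighbours H y
  path-interior H x (c ∷ []) (e , e′ , _) u z∉ (inj₁ x≢z) (here refl) =
    x , _ , x≢z , HasEdge-sym H e , e′
  path-interior H x (c ∷ []) p u z∉ (inj₂ (s≤s ())) (here refl)
  path-interior H x (c ∷ d ∷ l) (e , e′ , _) ((_ ∷ x≢d ∷ _) ∷ _) z∉ h (here refl) =
    x , d , x≢d , HasEdge-sym H e , e′
  path-interior H x (c ∷ l) (_ , p) (_ ∷ u) z∉ h (there y∈) =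
    path-interior H c l p u (z∉ ∘ there) (inj₁ (λ c≡z → z∉ (here (sym c≡z)))) y∈

  cycle-neighbours : ∀ {H} (c : Cycle Adj H) →
                     ∀ {y} → y ∈ Cycle.x₀ c ∷ Cycle.rest c → TwoNeighbours H y
  cycle-neighbours {H} record { x₀ = x ; rest = c ∷ d ∷ l ; uniq = _ ∷ (c≢ ∷ _) ; path = e , p }
    (here refl)
    with PathEdges-last H c d l p
  ... | a , a∈ , e′ = c , a , All.lookup c≢ a∈ , e , HasEdge-sym H e′
  cycle-neighbours record { rest = _ ∷ [] ; long = s≤s () } (here refl)
  cycle-neighbours {H} record { x₀ = x ; rest = l ; long = long ; uniq = u@(x∉ ∷ _) ; path = p }
    (there y∈) =
    path-interior H x l p u (λ x∈ → All.lookup x∉ x∈ refl) (inj₂ long) y∈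

module _ {V : Set} (_≟V_ : DecidableEquality V) {Adj : V → V → Set} where

  open import Data.List.Membership.DecPropositional _≟V_ using (_∈?_)

  module _ (Step : V → V → Set) (step-adj : ∀ {u v} → Step u v → Adj u v) (r : V) where

    -- Each new edge brings a new vertex, so connectedness and acyclicity become inductions over the
    -- way the tree was grown.
    data Grown : List V → List (V × V) → Set where
      root : Grown (r ∷ []) []
      leaf : ∀ {vs es u v} → Grown vs es → u ∈ vs → v ∉ vs → Step u v →
             Grown (v ∷ vs) ((u , v) ∷ es)

    grown-step : ∀ {vs es} → Grown vs es → ∀ {u v} → (u , v) ∈ es → Step u v
    grown-step (leaf g _ _ s) (here refl) = s
    grown-step (leaf g _ _ _) (there e)   = grown-step g e

    grown-in : ∀ {vs es} → Grown vs es → ∀ {u v} → (u , v) ∈ es → u ∈ vs × v ∈ vs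
    grown-in (leaf g u∈ _ _) (here refl) = there u∈ , here refl
    grown-in (leaf g _ _ _)  (there e) with grown-in g e
    ... | u∈ , v∈ = there u∈ , there v∈

    grown-graph : ∀ {vs es} → Grown vs es → Subgraph Adj
    grown-graph {vs} {es} g = record
      { verts = vs ; edges = es ; edgeAdj = step-adj ∘ grown-step g ; edgeIn = grown-in g }

    grown-root : ∀ {vs es} → Grown vs es → r ∈ vs
    grown-root root           = here refl
    grown-root (leaf g _ _ _) = there (grown-root g)

    reach-root : ∀ {vs es} (g : Grown vs es) {x} → x ∈ vs →
                 Star (HasEdge Adj (grown-graph g)) x r
    reach-root root (here refl) = ε
    reach-root (leaf g u∈ v∉ s) (here refl) =
      inj₂ (here refl) ◅ gmap id [ inj₁ ∘ there , inj₂ ∘ there ]′ (reach-root g u∈)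
    reach-root (leaf g u∈ v∉ s) (there x∈) =
      gmap id [ inj₁ ∘ there , inj₂ ∘ there ]′ (reach-root g x∈)

    grown-connected : ∀ {vs es} (g : Grown vs es) → Connected Adj (grown-graph g)
    grown-connected g x∈ y∈ =
      reach-root g x∈ ◅◅ reverse (HasEdge-sym (grown-graph g)) (reach-root g y∈)

    -- The last vertex has a single neighbour, so it lies on no cycle.
    grown-acyclic : ∀ {vs es} (g : Grown vs es) → ¬ Cycle Adj (grown-graph g)
    grown-acyclic root record { rest = _ ∷ _ ; path = inj₁ () , _ }
    grown-acyclic root record { rest = _ ∷ _ ; path = inj₂ () , _ }
    grown-acyclic root record { rest = [] ; long = () }
    grown-acyclic g′@(leaf {vs} {es} {u} {v} g u∈ v∉ s) c with v ∈? (Cycle.x₀ c ∷ Cycle.rest c)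
    ... | yes v∈ with cycle-neighbours c v∈
    ...   | a , b , a≢b , ea , eb = a≢b (trans (only ea) (sym (only eb)))
      where
      only : ∀ {w} → HasEdge Adj (grown-graph g′) v w → w ≡ u
      only (inj₁ (here refl)) = refl
      only (inj₁ (there e))   = contradiction (proj₁ (grown-in g e)) v∉
      only (inj₂ (here refl)) = refl
      only (inj₂ (there e))   = contradiction (proj₂ (grown-in g e)) v∉
    grown-acyclic g′@(leaf {vs} {es} {u} {v} g u∈ v∉ s) c | no v∉c = grown-acyclic g record
      { x₀ = x₀ ; rest = rest ; long = long ; uniq = uniq
      ; path = old-path x₀ (rest ++ x₀ ∷ []) closed path }
      where
      open Cycle c
      closed : v ∉ x₀ ∷ (rest ++ x₀ ∷ [])
      closed (here e) = v∉c (here e)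
      closed (there v∈) with ∈-++⁻ rest v∈
      ... | inj₁ v∈r       = v∉c (there v∈r)
      ... | inj₂ (here e)  = v∉c (here e)
      old : ∀ {x y} → v ≢ y → v ≢ x → HasEdge Adj (grown-graph g′) x y → HasEdge Adj (grown-graph g) x y
      old v≢y v≢x (inj₁ (here refl)) = contradiction refl v≢y
      old v≢y v≢x (inj₁ (there e))   = inj₁ e
      old v≢y v≢x (inj₂ (here refl)) = contradiction refl v≢x
      old v≢y v≢x (inj₂ (there e))   = inj₂ e
      old-path : ∀ x l → v ∉ x ∷ l → PathEdges Adj (grown-graph g′) x l → PathEdges Adj (grown-graph g) x l
      old-path x []      v∉ _       = _
      old-path x (y ∷ l) v∉ (e , p) =
        old (v∉ ∘ there ∘ here) (v∉ ∘ here) e , old-path y l (v∉ ∘ there) p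

    grown-verts : ∀ {P : V → Set} → P r → (∀ {u v} → Step u v → P v) →
                  ∀ {vs es} → Grown vs es → ∀ {x} → x ∈ vs → P x
    grown-verts pr ps root           (here refl) = pr
    grown-verts pr ps (leaf g _ _ s) (here refl) = ps s
    grown-verts pr ps (leaf g _ _ _) (there x∈)  = grown-verts pr ps g x∈

    -- A step to a vertex already present adds no edge, so a walk with repetitions, or one that
    -- meets the tree again, still leaves a tree.
    grow-along : ∀ {vs es u v} → Grown vs es → u ∈ vs → Star Step u v →
      ∃₂ λ vs′ es′ → Grown vs′ es′ × (∀ {x} → x ∈ vs → x ∈ vs′) × v ∈ vs′
    grow-along g u∈ ε = _ , _ , g , id , u∈
    grow-along {vs} g u∈ (_◅_ {j = w} s ss) with w ∈? vs
    ... | yes w∈ = grow-along g w∈ ss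
    ... | no  w∉ with grow-along (leaf g u∈ w∉ s) (here refl) ss
    ...   | _ , _ , g′ , sub , v∈ = _ , _ , g′ , sub ∘ there , v∈

    grow-all : ∀ xs → (∀ {x} → x ∈ xs → Star Step r x) →
      ∃₂ λ vs es → Grown vs es × (∀ {x} → x ∈ xs → x ∈ vs)
    grow-all []       _ = _ , _ , root , λ ()
    grow-all (x ∷ xs) w with grow-all xs (w ∘ there)
    ... | _ , _ , g , sub with grow-along g (grown-root g) (w (here refl))
    ...   | _ , _ , g′ , sub′ , x∈ =
      _ , _ , g′ , λ { (here refl) → x∈ ; (there y∈) → sub′ (sub y∈) }

  Routing⇒trees : ∀ {r S k} → Routing Adj (r ∷ S) k → InternallyDisjointSTrees Adj (r ∷ S) k
  Routing⇒trees {r} {S} {k} R = record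
    { tree = λ i → record
      { graph = grown-graph _ _ _ (g i)
      ; isTree = grown-connected _ _ _ (g i) , grown-acyclic _ _ _ (g i) }
    ; containsS = λ i → proj₂ (proj₂ (proj₂ (grown i)))
    ; edgeDisj = λ i j i≢j e e′ → i≢j (step-one (edge-step i e) (edge-step j e′))
    ; vertDisj = λ i j i≢j x∈ x∈′ → in-one (vertex-in i x∈) (vertex-in j x∈′) i≢j
    }
    where
    open Routing R
    grown : ∀ i → ∃₂ λ vs es → Grown (Step i) step-adj r vs es × (∀ {x} → x ∈ r ∷ S → x ∈ vs)
    grown i = grow-all (Step i) step-adj r (r ∷ S) (walk i (here refl))
    g : ∀ i → Grown (Step i) step-adj r (proj₁ (grown i)) (proj₁ (proj₂ (grown i)))
    g i = proj₁ (proj₂ (proj₂ (grown i)))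
    edge-step : ∀ i {u v} → HasEdge Adj (grown-graph _ _ _ (g i)) u v → Step i u v
    edge-step i (inj₁ e) = grown-step _ _ _ (g i) e
    edge-step i (inj₂ e) = step-sym (grown-step _ _ _ (g i) e)
    vertex-in : ∀ i {x} → x ∈ proj₁ (grown i) → In i x
    vertex-in i = grown-verts _ _ _ {In i} (in-S (here refl)) step-in (g i)

-- Coordinates by class, position and cluster

-- Vertices of the dual cube as (s , p , k): the class s, the bits p that may be
-- flipped within a cluster, and the bits k naming the cluster; the remaining
-- neighbour exchanges p and k.
Vertex : ℕ → Set
Vertex m = Bool × Q m × Q m

neighbour : ∀ {m} → Vertex m → Fin (suc m) → Vertex m
neighbour (s , p , k) zero    = not s , k , p
neighbour (s , p , k) (suc j) = s , p ⊕ j , k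

Adjacent : ∀ {m} → Vertex m → Vertex m → Set
Adjacent u v = ∃ λ i → v ≡ neighbour u i

⊕-∷ʳ-inject₁ : ∀ {m} (p : Q m) b j → (p ∷ʳ b) ⊕ inject₁ j ≡ (p ⊕ j) ∷ʳ b
⊕-∷ʳ-inject₁ (_ ∷ p) b zero    = refl
⊕-∷ʳ-inject₁ (c ∷ p) b (suc j) = cong (c ∷_) (⊕-∷ʳ-inject₁ p b j)

⊕-∷ʳ-fromℕ : ∀ {m} (p : Q m) b → (p ∷ʳ b) ⊕ fromℕ m ≡ p ∷ʳ not b
⊕-∷ʳ-fromℕ []      b = refl
⊕-∷ʳ-fromℕ (c ∷ p) b = cong (c ∷_) (⊕-∷ʳ-fromℕ p b)

⊕-++ˡ : ∀ {m n} (p : Q m) (q : Q n) j → (p Vec.++ q) ⊕ (j ↑ˡ n) ≡ (p ⊕ j) Vec.++ q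
⊕-++ˡ (_ ∷ p) q zero    = refl
⊕-++ˡ (b ∷ p) q (suc j) = cong (b ∷_) (⊕-++ˡ p q j)

⊕-++ʳ : ∀ {m n} (p : Q m) (q : Q n) j → (p Vec.++ q) ⊕ (m ↑ʳ j) ≡ p Vec.++ (q ⊕ j)
⊕-++ʳ []      q j = refl
⊕-++ʳ (b ∷ p) q j = cong (b ∷_) (⊕-++ʳ p q j)

lookup-extensional : ∀ {m} (p q : Q m) → (∀ i → lookup p i ≡ lookup q i) → p ≡ q
lookup-extensional []      []      _ = refl
lookup-extensional (b ∷ p) (c ∷ q) h = cong₂ _∷_ (h zero) (lookup-extensional p q (h ∘ suc))

⊕⇒differ : ∀ {m} {p q : Q m} j → q ≡ p ⊕ j → DiffExactlyAt p q j
⊕⇒differ {p = p} j refl =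
  (λ e → not-≢ (trans (sym (lookup-⊕ p j)) (sym e))) , λ k k≢j → sym (lookup-⊕-≢ p k≢j)

differ⇒⊕ : ∀ {m} {p q : Q m} j → DiffExactlyAt p q j → q ≡ p ⊕ j
differ⇒⊕ {p = p} {q} j (d , same) = lookup-extensional q (p ⊕ j) pointwise
  where
  pointwise : ∀ i → lookup q i ≡ lookup (p ⊕ j) i
  pointwise i with i ≟ᶠ j
  ... | yes refl = trans (¬-not (d ∘ sym)) (sym (lookup-⊕ p j))
  ... | no  i≢j  = trans (sym (same i i≢j)) (sym (lookup-⊕-≢ p i≢j))

module _ {m : ℕ} where

  -- The empty tail after `b` matches `2 * m`, which unfolds to `m + (m + 0)`.
  joinBits : Q m → Q m → Bool → DVert (suc m)
  joinBits a b s = (a Vec.++ (b Vec.++ [])) ∷ʳ s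

  -- The last bit decides which block may be flipped, so the blocks are stored in an order that
  -- depends on the class. Flipping only the last bit therefore appears as the exchange of `p` and
  -- `k`.
  encode : Vertex m → DVert (suc m)
  encode (false , p , k) = joinBits p k false
  encode (true  , p , k) = joinBits k p true

  fromBits : Q m → Q m → Bool → Vertex m
  fromBits a b false = false , a , b
  fromBits a b true  = true , b , a

  encode-fromBits : ∀ a b s → encode (fromBits a b s) ≡ joinBits a b s
  encode-fromBits a b false = refl
  encode-fromBits a b true  = refl

  joinBits-surjective : ∀ u → ∃ λ a → ∃₂ λ b s → u ≡ joinBits a b s
  joinBits-surjective u with initLast u
  ... | w , s , refl with Vec.splitAt m w
  ...   | a , r , refl with Vec.splitAt m r
  ...     | b , [] , refl = a , b , s , refl

  joinBits-injective : ∀ a b a′ b′ {s s′} → joinBits a b s ≡ joinBits a′ b′ s′ →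
                       a ≡ a′ × b ≡ b′ × s ≡ s′
  joinBits-injective a b a′ b′ e with ∷ʳ-injective (a Vec.++ (b Vec.++ [])) (a′ Vec.++ (b′ Vec.++ [])) e
  ... | e′ , s≡ with ++-injective a a′ e′
  ...   | a≡ , e″ = a≡ , proj₁ (++-injective b b′ e″) , s≡

  encode-injective : ∀ {u v} → encode u ≡ encode v → u ≡ v
  encode-injective {false , p , k} {false , p′ , k′} e with joinBits-injective p k p′ k′ e
  ... | refl , refl , _ = refl
  encode-injective {true  , p , k} {true  , p′ , k′} e with joinBits-injective k p k′ p′ e
  ... | refl , refl , _ = refl
  encode-injective {false , p , k} {true  , p′ , k′} e with joinBits-injective p k k′ p′ e
  ... | _ , _ , ()
  encode-injective {true  , p , k} {false , p′ , k′} e with joinBits-injective k p p′ k′ e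
  ... | _ , _ , ()

  decode : DVert (suc m) → Vertex m
  decode u with joinBits-surjective u
  ... | a , b , s , _ = fromBits a b s

  encode-decode : ∀ u → encode (decode u) ≡ u
  encode-decode u with joinBits-surjective u
  ... | a , b , s , e = trans (encode-fromBits a b s) (sym e)

  decode-encode : ∀ v → decode (encode v) ≡ v
  decode-encode v = encode-injective (encode-decode (encode v))

  position : Bool → Fin m → Fin (suc (2 * m))
  position false j = inject₁ (j ↑ˡ (m + 0))
  position true  j = inject₁ (m ↑ʳ (j ↑ˡ 0))

  encode-⊕ : ∀ s p k j → encode (s , p ⊕ j , k) ≡ encode (s , p , k) ⊕ position s j
  encode-⊕ false p k j = sym (trans (⊕-∷ʳ-inject₁ _ _ _) (cong (_∷ʳ false) (⊕-++ˡ p _ j)))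
  encode-⊕ true  p k j = sym (trans (⊕-∷ʳ-inject₁ _ _ _) (cong (_∷ʳ true)
    (trans (⊕-++ʳ k _ _) (cong (k Vec.++_) (⊕-++ˡ p _ j)))))

  encode-cross : ∀ s p k → encode (not s , k , p) ≡ encode (s , p , k) ⊕ fromℕ (2 * m)
  encode-cross false p k = sym (⊕-∷ʳ-fromℕ _ _)
  encode-cross true  p k = sym (⊕-∷ʳ-fromℕ _ _)

  last-encode : ∀ s p k → last (encode (s , p , k)) ≡ s
  last-encode false p k = last-∷ʳ false (p Vec.++ (k Vec.++ []))
  last-encode true  p k = last-∷ʳ true (k Vec.++ (p Vec.++ []))

  toℕ-position-false : ∀ j → toℕ (position false j) ≡ toℕ j
  toℕ-position-false j = trans (toℕ-inject₁ _) (toℕ-↑ˡ j _)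

  toℕ-position-true : ∀ j → toℕ (position true j) ≡ m + toℕ j
  toℕ-position-true j =
    trans (toℕ-inject₁ _) (trans (toℕ-↑ʳ m _) (cong (m +_) (toℕ-↑ˡ j 0)))

  m+toℕ<2m : ∀ (j : Fin m) → m + toℕ j < 2 * m
  m+toℕ<2m j = subst (λ x → m + toℕ j < m + x) (sym (+-identityʳ m)) (+-monoʳ-< m (toℕ<n j))

  encode-adjacent : ∀ {u v} → Adjacent u v → DAdj (suc m) (encode u) (encode v)
  encode-adjacent {s , p , k} (zero , refl) =
    fromℕ (2 * m) , ⊕⇒differ _ (encode-cross s p k) , inj₂ (inj₂ (toℕ-fromℕ (2 * m)))
  encode-adjacent {false , p , k} (suc j , refl) =
    position false j , ⊕⇒differ _ (encode-⊕ false p k j) ,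
    inj₁ (subst (_< m) (sym (toℕ-position-false j)) (toℕ<n j)
         , last-encode false p k , last-encode false (p ⊕ j) k)
  encode-adjacent {true , p , k} (suc j , refl) =
    position true j , ⊕⇒differ _ (encode-⊕ true p k j) ,
    inj₂ (inj₁ ((subst (m ≤_) (sym (toℕ-position-true j)) (m≤m+n m (toℕ j))
                , subst (_< 2 * m) (sym (toℕ-position-true j)) (m+toℕ<2m j))
               , last-encode true p k , last-encode true (p ⊕ j) k))

  data Position : Fin (suc (2 * m)) → Set where
    inner : ∀ s j → Position (position s j)
    outer : Position (fromℕ (2 * m))

  position-view : ∀ i → Position i
  position-view i with view i
  ... | ‵fromℕ = outer
  ... | ‵inject₁ i′ with F.splitAt m {m + 0} i′ | join-splitAt m (m + 0) i′
  ...   | inj₁ j | refl = inner false j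
  ...   | inj₂ r | refl with F.splitAt m {0} r | join-splitAt m 0 r
  ...     | inj₁ j | refl = inner true j

  encode-adjacent⁻¹ : ∀ {u v} → DAdj (suc m) (encode u) (encode v) → Adjacent u v
  encode-adjacent⁻¹ {s , p , k} {v} (i , d , c) with differ⇒⊕ i d | position-view i
  ... | e | outer = zero , encode-injective (trans e (sym (encode-cross s p k)))
  ... | e | inner t j = same s t e c
    where
    same : ∀ s t → encode v ≡ encode (s , p , k) ⊕ position t j →
      (toℕ (position t j) < m × last (encode (s , p , k)) ≡ false × last (encode v) ≡ false)
      ⊎ ((m ≤ toℕ (position t j) × toℕ (position t j) < 2 * m)
         × last (encode (s , p , k)) ≡ true × last (encode v) ≡ true)
      ⊎ toℕ (position t j) ≡ 2 * m → Adjacent (s , p , k) v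
    same false false e _ = suc j , encode-injective (trans e (sym (encode-⊕ false p k j)))
    same true  true  e _ = suc j , encode-injective (trans e (sym (encode-⊕ true p k j)))
    same true  false e (inj₁ (_ , l , _)) =
      contradiction (trans (sym (last-encode true p k)) l) λ ()
    same false true  e (inj₁ (lt , _)) =
      contradiction (m≤m+n m (toℕ j)) (<⇒≱ (subst (_< m) (toℕ-position-true j) lt))
    same true  false e (inj₂ (inj₁ ((ge , _) , _))) =
      contradiction (subst (m ≤_) (toℕ-position-false j) ge) (<⇒≱ (toℕ<n j))
    same false true  e (inj₂ (inj₁ (_ , l , _))) =
      contradiction (trans (sym (last-encode false p k)) l) λ ()
    same true  false e (inj₂ (inj₂ eq)) = contradiction (trans (sym (toℕ-position-false j)) eq)
      (<⇒≢ (<-≤-trans (toℕ<n j) (m≤m+n m _)))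
    same false true  e (inj₂ (inj₂ eq)) =
      contradiction (trans (sym (toℕ-position-true j)) eq) (<⇒≢ (m+toℕ<2m j))

  decode-adjacent : ∀ {u v} → DAdj (suc m) u v → Adjacent (decode u) (decode v)
  decode-adjacent {u} {v} a =
    encode-adjacent⁻¹ (subst₂ (DAdj (suc m)) (sym (encode-decode u)) (sym (encode-decode v)) a)

  decode-injective : ∀ {u v} → decode u ≡ decode v → u ≡ v
  decode-injective {u} {v} e =
    trans (sym (encode-decode u)) (trans (cong encode e) (encode-decode v))

Adjacent-sym : ∀ {m} {u v : Vertex m} → Adjacent u v → Adjacent v u
Adjacent-sym {u = s , p , k} (zero  , refl) = zero , cong (_, p , k) (sym (not-involutive s))
Adjacent-sym {u = s , p , k} (suc j , refl) = suc j , cong (λ q → s , q , k) (sym (⊕-involutive p j))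

-- The upper bound

-- A missed value could be punched out, giving an injection into a smaller set.
injective⇒surjective : ∀ {n} (f : Fin n → Fin n) → (∀ {i j} → f i ≡ f j → i ≡ j) →
                       ∀ y → ∃ λ i → f i ≡ y
injective⇒surjective {suc n} f inj y with any? (λ i → f i ≟ᶠ y)
... | yes r = r
... | no ¬r = contradiction
  (injective⇒≤ {f = λ i → punchOut (λ e → ¬r (i , sym e))}
    (λ {i} {j} e → inj (punchOut-injective (λ e → ¬r (i , sym e)) (λ e → ¬r (j , sym e)) e)))
  1+n≰n

-- Each of suc m trees has degree one at both x and y, so the tree through the edge xy
-- consists of that edge only.
module _ {m : ℕ} where

  private
    Adj : DVert (suc m) → DVert (suc m) → Set
    Adj = DAdj (suc m)

  module _ {S} (T : InternallyDisjointSTrees Adj S (suc m)) where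

    open InternallyDisjointSTrees T

    G : Fin (suc m) → Subgraph Adj
    G i = graph (tree i)

    edge-neighbour : ∀ i {x w} → HasEdge Adj (G i) x w → ∃ λ d → decode w ≡ neighbour (decode x) d
    edge-neighbour i (inj₁ e) = decode-adjacent (edgeAdj (G i) e)
    edge-neighbour i (inj₂ e) = Adjacent-sym (decode-adjacent (edgeAdj (G i) e))

    module AtVertex {x z} (x∈ : x ∈ S) (z∈ : z ∈ S) (x≢z : x ≢ z) where

      first-edge : ∀ i → ∃ λ w → HasEdge Adj (G i) x w
      first-edge i with proj₁ (isTree (tree i)) (containsS i x∈) (containsS i z∈)
      ... | ε     = contradiction refl x≢z
      ... | e ◅ _ = _ , e

      slot : Fin (suc m) → Fin (suc m)
      slot i = proj₁ (edge-neighbour i (proj₂ (first-edge i)))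

      same-tree : ∀ {i j w w′} (e : HasEdge Adj (G i) x w) (e′ : HasEdge Adj (G j) x w′) →
                  proj₁ (edge-neighbour i e) ≡ proj₁ (edge-neighbour j e′) → i ≡ j
      same-tree {i} {j} {w} {w′} e e′ same with i ≟ᶠ j
      ... | yes i≡j = i≡j
      ... | no  i≢j = contradiction (subst (HasEdge Adj (G j) x) w′≡w e′) (edgeDisj i j i≢j e)
        where
        w′≡w : w′ ≡ w
        w′≡w = decode-injective (trans (proj₂ (edge-neighbour j e′))
          (trans (cong (neighbour (decode x)) (sym same)) (sym (proj₂ (edge-neighbour i e)))))

      slot-surjective : ∀ d → ∃ λ i → slot i ≡ d
      slot-surjective = injective⇒surjective slot (same-tree (proj₂ (first-edge _)) (proj₂ (first-edge _)))

      -- The direction of any edge of tree `i` at `x` is also the slot of some tree. The two trees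
      -- then share an edge, so they are the same tree.
      has-slot : ∀ {i w} (e : HasEdge Adj (G i) x w) → slot i ≡ proj₁ (edge-neighbour i e)
      has-slot {i} e with slot-surjective (proj₁ (edge-neighbour i e))
      ... | j , s≡ = subst (λ h → slot h ≡ _) (same-tree (proj₂ (first-edge j)) e s≡) s≡

      single-edge : ∀ {i w w′} → HasEdge Adj (G i) x w → HasEdge Adj (G i) x w′ → w ≡ w′
      single-edge {i} e e′ = decode-injective (trans (proj₂ (edge-neighbour i e))
        (trans (cong (neighbour (decode x)) (trans (sym (has-slot e)) (has-slot e′)))
          (sym (proj₂ (edge-neighbour i e′)))))

      covered : ∀ {w} → Adj x w → ∃ λ i → HasEdge Adj (G i) x w
      covered {w} a with decode-adjacent a
      ... | d , w≡ with slot-surjective d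
      ...   | i , refl = i , subst (HasEdge Adj (G i) x)
        (decode-injective (trans (proj₂ (edge-neighbour i (proj₂ (first-edge i)))) (sym w≡)))
        (proj₂ (first-edge i))

    no-full-packing : ∀ {x y z} → x ∈ S → y ∈ S → z ∈ S → x ≢ y → z ≢ x → z ≢ y → Adj x y → ⊥
    no-full-packing {x} {y} {z} x∈ y∈ z∈ x≢y z≢x z≢y a
      with AtVertex.covered x∈ y∈ x≢y a
    ... | i , e = [ z≢x , z≢y ]′ (stay (inj₁ refl)
            (proj₁ (isTree (tree i)) (containsS i x∈) (containsS i z∈)))
      where
      step : ∀ {u w} → u ≡ x ⊎ u ≡ y → HasEdge Adj (G i) u w → w ≡ x ⊎ w ≡ y
      step (inj₁ refl) e′ = inj₂ (AtVertex.single-edge x∈ y∈ x≢y e′ e)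
      step (inj₂ refl) e′ = inj₁ (AtVertex.single-edge y∈ x∈ (x≢y ∘ sym) e′ (HasEdge-sym (G i) e))
      stay : ∀ {u w} → u ≡ x ⊎ u ≡ y → Star (HasEdge Adj (G i)) u w → w ≡ x ⊎ w ≡ y
      stay h ε        = h
      stay h (e ◅ es) = stay (step h e) es

-- Colourings

ClusterIn : ∀ {m n} → (Q m → Set) → (Q m → Fin n) → Fin n → Q m → Set
ClusterIn P ψ c p = P p ⊎ ψ p ≡ c

-- `Colouring.Step` restricted to one cluster. Stated for a bare cube with a set `P`, it lets the
-- constructions inside a cluster ignore the rest of the graph.
ClusterStep : ∀ {m n} → (Q m → Set) → (Q m → Fin n) → (Q m → Fin m → Fin n) → Fin n →
              Q m → Q m → Set
ClusterStep P ψ η c p q = ∃ λ j →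
  q ≡ p ⊕ j × ClusterIn P ψ c p × ClusterIn P ψ c q × (P p → P q → η p j ≡ c)

-- Vertices outside S are coloured by χ: a cluster avoiding S gets the single
-- colour L, a cluster meeting S is coloured by ψ.  An edge between two vertices of
-- S is coloured by η inside a cluster, and by the label of the class-true cluster
-- otherwise.  The i-th tree uses colour i together with S.
module Colouring {m : ℕ} (S : List (Vertex m)) (L : Bool → Q m → Fin m)
  (ψ : Bool → Q m → Q m → Fin m) (η : Bool → Q m → Q m → Fin m → Fin m)
  (η-sym : ∀ s k p j → η s k (p ⊕ j) j ≡ η s k p j) where

  Meets : Bool → Q m → Set
  Meets s k = ∃ λ p → (s , p , k) ∈ S

  meets? : ∀ s k → Dec (Meets s k)
  meets? s k = search S
    where
    search : ∀ T → Dec (∃ λ p → (s , p , k) ∈ T)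
    search [] = no λ ()
    search ((s′ , p , k′) ∷ T) with s ≟ᵇ s′ | k ≟ k′ | search T
    ... | yes refl | yes refl | _           = yes (p , here refl)
    ... | yes _    | no _     | yes (q , h) = yes (q , there h)
    ... | no _     | _        | yes (q , h) = yes (q , there h)
    ... | yes _    | no k≢    | no ¬h = no λ { (_ , here refl) → k≢ refl ; (q , there h) → ¬h (q , h) }
    ... | no s≢    | _        | no ¬h = no λ { (_ , here refl) → s≢ refl ; (q , there h) → ¬h (q , h) }

  χ : Vertex m → Fin m
  χ (s , p , k) = pick (meets? s k) (ψ s k p) (L s k)

  χ-meets : ∀ {s p k} → Meets s k → χ (s , p , k) ≡ ψ s k p
  χ-meets {s} {p} {k} = pick-yes (meets? s k)

  χ-avoids : ∀ {s p k} → ¬ Meets s k → χ (s , p , k) ≡ L s k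
  χ-avoids {s} {p} {k} = pick-no (meets? s k)

  along : Bool → Q m → Q m → Q m → Fin m
  along s k p q with direction p q
  -- A default: the ends of an edge within a cluster differ.
  ... | zero  = L s k
  ... | suc j = η s k p j

  along-⊕ : ∀ s k p j → along s k p (p ⊕ j) ≡ η s k p j
  along-⊕ s k p j rewrite direction-⊕ p j = refl

  along-⊕ˡ : ∀ s k p j → along s k (p ⊕ j) p ≡ η s k p j
  along-⊕ˡ s k p j rewrite direction-⊕ˡ p j = η-sym s k p j

  colour : Vertex m → Vertex m → Fin m
  colour (false , p , k) (false , q , _) = along false k p q
  colour (true  , p , k) (true  , q , _) = along true k p q
  colour (false , p , _) (true  , _ , _) = L true p
  colour (true  , _ , k) (false , _ , _) = L true k

  colour-sym : ∀ {u v} → Adjacent u v → colour u v ≡ colour v u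
  colour-sym {false , p , k} (zero , refl) = refl
  colour-sym {true  , p , k} (zero , refl) = refl
  colour-sym {false , p , k} (suc j , refl) = trans (along-⊕ false k p j) (sym (along-⊕ˡ false k p j))
  colour-sym {true  , p , k} (suc j , refl) = trans (along-⊕ true k p j) (sym (along-⊕ˡ true k p j))

  In : Fin m → Vertex m → Set
  In c v = v ∈ S ⊎ χ v ≡ c

  Step : Fin m → Vertex m → Vertex m → Set
  Step c u v = Adjacent u v × In c u × In c v × (u ∈ S → v ∈ S → colour u v ≡ c)

  Step-sym : ∀ {c u v} → Step c u v → Step c v u
  Step-sym (a , i , j , h) = Adjacent-sym a , j , i , λ v∈ u∈ → trans (sym (colour-sym a)) (h u∈ v∈)

  in-one : ∀ {i j x} → In i x → In j x → i ≡ j ⊎ x ∈ S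
  in-one (inj₁ x∈) _         = inj₂ x∈
  in-one _         (inj₁ x∈) = inj₂ x∈
  in-one (inj₂ e)  (inj₂ e′) = inj₁ (trans (sym e) e′)

  step-one : ∀ {i j u v} → Step i u v → Step j u v → i ≡ j
  step-one (_ , a , b , h) (_ , a′ , b′ , h′) with in-one a a′ | in-one b b′
  ... | inj₁ e  | _       = e
  ... | inj₂ _  | inj₁ e  = e
  ... | inj₂ u∈ | inj₂ v∈ = trans (sym (h u∈ v∈)) (h′ u∈ v∈)

  routing : (hub : Fin m → Vertex m) → (∀ c {x} → x ∈ S → Star (Step c) x (hub c)) →
            Routing Adjacent S m
  routing hub to-hub = record
    { Step = Step ; In = In ; step-adj = proj₁ ; step-in = proj₁ ∘ proj₂ ∘ proj₂
    ; step-sym = Step-sym ; step-one = step-one ; in-S = inj₁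
    ; in-one = λ a b i≢j → [ (λ e → contradiction e i≢j) , id ]′ (in-one a b)
    ; walk = λ c x∈ y∈ → to-hub c x∈ ◅◅ reverse Step-sym (to-hub c y∈)
    }

  avoids-∉ : ∀ {s p k} → ¬ Meets s k → (s , p , k) ∉ S
  avoids-∉ ¬h x∈ = ¬h (_ , x∈)

  in-avoiding : ∀ {s p k c} → ¬ Meets s k → L s k ≡ c → In c (s , p , k)
  in-avoiding ¬h e = inj₂ (trans (χ-avoids ¬h) e)

  free-walk : ∀ {s k c} → ¬ Meets s k → L s k ≡ c → ∀ p q → Star (Step c) (s , p , k) (s , q , k)
  free-walk {s} {k} ¬h e p q = gmap (λ p → s , p , k)
    (λ (j , e′) → (suc j , cong (λ p → s , p , k) e′) , in-avoiding ¬h e , in-avoiding ¬h e ,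
      λ x∈ → contradiction x∈ (avoids-∉ ¬h))
    (cube-connected p q)

  cross-out : ∀ {s k c} w → ¬ Meets (not s) w → L (not s) w ≡ c → In c (s , w , k) →
              Step c (s , w , k) (not s , k , w)
  cross-out w ¬h e i = (zero , refl) , i , in-avoiding ¬h e , λ _ x∈ → contradiction x∈ (avoids-∉ ¬h)

  cross-S : ∀ {k c} w → L true w ≡ c → In c (false , w , k) → In c (true , k , w) →
            Step c (false , w , k) (true , k , w)
  cross-S w e i i′ = (zero , refl) , i , i′ , λ _ _ → e

  in-cluster : ∀ {s k c p} → Meets s k → ClusterIn (λ q → (s , q , k) ∈ S) (ψ s k) c p → In c (s , p , k)
  in-cluster h (inj₁ p∈) = inj₁ p∈
  in-cluster h (inj₂ e)  = inj₂ (trans (χ-meets h) e)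

  cluster-walk : ∀ {s k c p q} → Meets s k →
    Star (ClusterStep (λ q → (s , q , k) ∈ S) (ψ s k) (η s k) c) p q →
    Star (Step c) (s , p , k) (s , q , k)
  cluster-walk {s} {k} {c} h = gmap (λ p → s , p , k) step
    where
    along-colour : ∀ s p j → colour (s , p , k) (s , p ⊕ j , k) ≡ η s k p j
    along-colour false p j = along-⊕ false k p j
    along-colour true  p j = along-⊕ true k p j
    step : ∀ {p q} → ClusterStep (λ q → (s , q , k) ∈ S) (ψ s k) (η s k) c p q →
           Step c (s , p , k) (s , q , k)
    step {p} (j , refl , i , i′ , e) = (suc j , refl) , in-cluster h i , in-cluster h i′ ,
      λ p∈ q∈ → trans (along-colour s p j) (e p∈ q∈)

  -- Colour `c` gathers in the class-false cluster `β c`. Every class-true cluster has its edge into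
  -- that cluster at position `β c`; a class-false vertex first passes through a class-true cluster
  -- of its colour.
  module Hubs (β : Fin m → Q m) (β-avoids : ∀ c → ¬ Meets false (β c))
              (β-label : ∀ c → L false (β c) ≡ c) where

    hub : Fin m → Vertex m
    hub c = false , Vec.replicate m false , β c

    exit-true : ∀ {k c} → In c (true , β c , k) → Star (Step c) (true , β c , k) (hub c)
    exit-true {k} {c} i =
      cross-out (β c) (β-avoids c) (β-label c) i ◅ free-walk (β-avoids c) (β-label c) _ _

    exit-false : ∀ {k c} w → ¬ Meets true w → L true w ≡ c → In c (false , w , k) →
                 Star (Step c) (false , w , k) (hub c)
    exit-false {k} {c} w ¬h e i =
      cross-out w ¬h e i ◅ free-walk ¬h e _ _ ◅◅ exit-true (in-avoiding ¬h e)

-- Disjoint paths in a cube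

-- The m paths are internally disjoint because the j-th one has inner vertices of colour j.
record Paths {m} (p o : Q m) : Set where
  field
    κ : Q m → Fin m

  Inside : Fin m → Q m → Q m → Set
  Inside j u w = Edge u w × κ w ≡ j × w ≢ p × w ≢ o

  field
    κ-end  : ∀ j → κ (o ⊕ j) ≡ j
    κ-path : ∀ j → o ⊕ j ≢ p → Star (Inside j) p (o ⊕ j)

∷-≢ : ∀ {m b} {p q : Q m} → p ≢ q → b ∷ p ≢ b ∷ q
∷-≢ p≢q refl = p≢q refl

not∷-≢ : ∀ {m b} {p q : Q m} → not b ∷ p ≢ b ∷ q
not∷-≢ e = not-≢ (cong Vec.head e)

∷-edge : ∀ {m b} {p q : Q m} → Edge p q → Edge (b ∷ p) (b ∷ q)
∷-edge {b = b} (j , e) = suc j , cong (b ∷_) e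

-- Induction on the first bit. If it agrees, one further path runs through the opposite half. If
-- only it differs, each path is a detour around a square. If more differs, the copy of `p` in the
-- half of `o` lies on the path of colour `κ p`; that path must cross at once, while the other paths
-- cross just before their end.
disjoint-paths : ∀ {m} (p o : Q m) → p ≢ o → Paths p o
disjoint-paths []      []      p≢o = contradiction refl p≢o
disjoint-paths (a ∷ p) (b ∷ o) p≢o with a ≟ᵇ b | p ≟ o
... | yes refl | yes refl = contradiction refl p≢o
... | yes refl | no p≢o′ = record { κ = κ ; κ-end = end ; κ-path = path }
  where
  module I = Paths (disjoint-paths p o p≢o′)
  κ : Q _ → Fin _
  κ (c ∷ w) = pick (c ≟ᵇ b) (suc (I.κ w)) zero
  end : ∀ j → κ ((b ∷ o) ⊕ j) ≡ j
  end zero    = pick-no (not b ≟ᵇ b) not-≢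
  end (suc j) = trans (pick-yes (b ≟ᵇ b) refl) (cong suc (I.κ-end j))
  path : ∀ j → (b ∷ o) ⊕ j ≢ b ∷ p → Star _ (b ∷ p) ((b ∷ o) ⊕ j)
  path zero _ = ((zero , refl) , pick-no (not b ≟ᵇ b) not-≢ , not∷-≢ , not∷-≢) ◅
    gmap (not b ∷_) (λ e → ∷-edge e , pick-no (not b ≟ᵇ b) not-≢ , not∷-≢ , not∷-≢) (cube-connected p o)
  path (suc j) ne = gmap (b ∷_)
    (λ (e , k , x , y) → ∷-edge e , trans (pick-yes (b ≟ᵇ b) refl) (cong suc k) , ∷-≢ x , ∷-≢ y)
    (I.κ-path j (ne ∘ cong (b ∷_)))
... | no a≢b | yes refl with refl ← ¬-not a≢b = record { κ = κ ; κ-end = end ; κ-path = path }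
  where
  κ : Q _ → Fin _
  κ (c ∷ w) = direction p w
  end : ∀ j → κ ((b ∷ p) ⊕ j) ≡ j
  end zero    = direction-refl p
  end (suc j) = direction-⊕ p j
  path : ∀ j → (b ∷ p) ⊕ j ≢ not b ∷ p → Star _ (not b ∷ p) ((b ∷ p) ⊕ j)
  path zero    ne = contradiction refl ne
  path (suc j) ne =
    ((suc j , refl) , direction-⊕ p j , ∷-≢ (⊕-≢ p j) , not∷-≢) ◅
    ((zero , cong (_∷ p ⊕ j) (sym (not-involutive b))) , direction-⊕ p j , not∷-≢ ∘ sym , ∷-≢ (⊕-≢ p j)) ◅ ε
... | no a≢b | no p≢o′ with refl ← ¬-not a≢b = record { κ = κ ; κ-end = end ; κ-path = path }
  where
  -- The path of colour j₀ is used twice, once in either half.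
  module I = Paths (disjoint-paths p o p≢o′)
  j₀ = I.κ p
  far : Q _ → Fin _
  far w = pick (w ≟ o) zero (pick (I.κ w ≟ᶠ j₀) zero (suc (I.κ w)))
  κ : Q _ → Fin _
  κ (c ∷ w) = pick (c ≟ᵇ b) (suc (I.κ w)) (far w)
  κ-near : ∀ {w} → κ (b ∷ w) ≡ suc (I.κ w)
  κ-near = pick-yes (b ≟ᵇ b) refl
  κ-far : ∀ {w} → κ (not b ∷ w) ≡ far w
  κ-far = pick-no (not b ≟ᵇ b) not-≢
  end : ∀ j → κ ((b ∷ o) ⊕ j) ≡ j
  end zero    = trans κ-far (pick-yes (o ≟ o) refl)
  end (suc j) = trans κ-near (cong suc (I.κ-end j))
  far-zero : ∀ {w} → I.κ w ≡ j₀ → far w ≡ zero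
  far-zero {w} e with w ≟ o
  ... | yes _ = refl
  ... | no  _ = pick-yes (I.κ w ≟ᶠ j₀) e
  far-suc : ∀ {j w} → I.κ w ≡ j → j ≢ j₀ → w ≢ o → far w ≡ suc j
  far-suc {j} {w} refl ne w≢o = trans (pick-no (w ≟ o) w≢o) (pick-no (I.κ w ≟ᶠ j₀) ne)
  to-end : Star (I.Inside j₀) p (o ⊕ j₀)
  to-end with (o ⊕ j₀) ≟ p
  ... | yes e = subst (Star _ p) (sym e) ε
  ... | no ne = I.κ-path j₀ ne
  path : ∀ j → (b ∷ o) ⊕ j ≢ not b ∷ p → Star _ (not b ∷ p) ((b ∷ o) ⊕ j)
  path zero _ = gmap (not b ∷_)
      (λ (e , k , x , y) → ∷-edge e , trans κ-far (far-zero k) , ∷-≢ x , not∷-≢)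
      to-end
    ◅◅ ((suc j₀ , cong (not b ∷_) (⊕-sym j₀ refl)) , end zero , ∷-≢ (p≢o′ ∘ sym) , not∷-≢) ◅ ε
  path (suc j) ne with j ≟ᶠ j₀
  ... | yes refl =
    ((zero , cong (_∷ p) (sym (not-involutive b))) , κ-near , not∷-≢ ∘ sym , ∷-≢ p≢o′) ◅
    gmap (b ∷_)
      (λ (e , k , x , y) → ∷-edge e , trans κ-near (cong suc k) , not∷-≢ ∘ sym , ∷-≢ y)
      to-end
  ... | no j≢j₀ = gmap (not b ∷_)
      (λ (e , k , x , y) → ∷-edge e , trans κ-far (far-suc k j≢j₀ y) , ∷-≢ x , not∷-≢)
      (I.κ-path j (λ e → j≢j₀ (trans (sym (I.κ-end j)) (cong I.κ e))))
    ◅◅ ((zero , cong (_∷ o ⊕ j) (sym (not-involutive b))) , end (suc j) , not∷-≢ ∘ sym , ∷-≢ (⊕-≢ o j)) ◅ ε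

-- Colour c follows a path from p to o and leaves the cluster either just before o or at o.
module Centre {m} (P : Q m → Set) (L : Q m → Fin m) (o : Q m) (p : Q m) (p≢o : p ≢ o)
  (P⊆ : ∀ {q} → P q → q ≡ o ⊎ q ≡ p)
  (j : Fin m → Fin m) (L-j : ∀ c → L (o ⊕ j c) ≡ c)
  (ex : Fin m → Q m) (ex-at : ∀ c → ex c ≡ o ⊕ j c ⊎ (ex c ≡ o × L o ≡ c)) where

  open Paths (disjoint-paths p o p≢o)

  ψ : Q m → Fin m
  ψ w = pick (w ≟ o) (L o) (L (o ⊕ κ w))

  η : Q m → Fin m → Fin m
  η _ i = L (o ⊕ i)

  ψ-centre : ψ o ≡ L o
  ψ-centre = pick-yes (o ≟ o) refl

  ψ-path : ∀ {w c} → w ≢ o → κ w ≡ j c → ψ w ≡ c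
  ψ-path {w} {c} w≢o e =
    trans (pick-no (w ≟ o) w≢o) (trans (cong (λ i → L (o ⊕ i)) e) (L-j c))

  ψ-end : ∀ c → ψ (o ⊕ j c) ≡ c
  ψ-end c = ψ-path (⊕-≢ o (j c)) (κ-end (j c))

  centre-in : ∀ {c} → L o ≡ c → ClusterIn P ψ c o
  centre-in e = inj₂ (trans ψ-centre e)

  ex-in : ∀ c → ClusterIn P ψ c (ex c)
  ex-in c with ex c | ex-at c
  ... | _ | inj₁ refl       = inj₂ (ψ-end c)
  ... | _ | inj₂ (refl , e) = centre-in e

  from-centre : ∀ c → ClusterIn P ψ c o → Star (ClusterStep P ψ η c) o (ex c)
  from-centre c i with ex c | ex-at c
  ... | _ | inj₁ refl       = (j c , refl , i , inj₂ (ψ-end c) , λ _ _ → L-j c) ◅ ε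
  ... | _ | inj₂ (refl , _) = ε

  to-exit : ∀ {x} c → P x → Star (ClusterStep P ψ η c) x (ex c)
  to-exit {x} c x∈ with P⊆ x∈
  ... | inj₁ refl = from-centre c (inj₁ x∈)
  ... | inj₂ refl = to-end ◅◅ from-end
    where
    inside : ∀ {u w} → ClusterIn P ψ c u → Star (Inside (j c)) u w → Star (ClusterStep P ψ η c) u w
    inside i ε = ε
    inside i (((h , e) , k , w≢p , w≢o) ◅ ws) =
      (h , e , i , inj₂ (ψ-path w≢o k) , λ _ w∈ → contradiction (P⊆ w∈) [ w≢o , w≢p ]′) ◅
      inside (inj₂ (ψ-path w≢o k)) ws
    to-end : Star (ClusterStep P ψ η c) p (o ⊕ j c)
    to-end with (o ⊕ j c) ≟ p
    ... | yes e = subst (Star _ p) (sym e) ε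
    ... | no ne = inside (inj₁ x∈) (κ-path (j c) ne)
    from-end : Star (ClusterStep P ψ η c) (o ⊕ j c) (ex c)
    from-end with ex c | ex-at c
    ... | _ | inj₁ refl       = ε
    ... | _ | inj₂ (refl , e) =
      (j c , ⊕-sym (j c) refl , inj₂ (ψ-end c) , centre-in e , λ _ _ → L-j c) ◅ ε

infix 4 _≐_

_≐_ : {A : Set} → (A → Set) → (A → Set) → Set
P ≐ P′ = (∀ {x} → P x → P′ x) × (∀ {x} → P′ x → P x)

≐-↭ : ∀ {A : Set} {P : A → Set} {xs ys} → xs ↭ ys → P ≐ (_∈ xs) → P ≐ (_∈ ys)
≐-↭ p (to , from) = ∈-resp-↭ p ∘ to , from ∘ ∈-resp-↭ (↭-sym p)

Unique-↭ : ∀ {A : Set} {xs ys : List A} → xs ↭ ys → Unique xs → Unique ys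
Unique-↭ {A} p = PermutationSetoid.Unique-resp-↭ (setoid A) (↭⇒↭ₛ p)

≐-sym : ∀ {A : Set} {P P′ : A → Set} → P ≐ P′ → P′ ≐ P
≐-sym (to , from) = from , to

-- Labellings around two, three and four points of a cube

-- φ labels the cluster opposite to each position.
data Sees {m n} (P : Q m → Set) (φ : Q m → Fin n) (η : Q m → Fin m → Fin n) (c : Fin n) :
          Q m → Set where
  own  : ∀ {x} → φ x ≡ c → Sees P φ η c x
  port : ∀ {x} j → ¬ P (x ⊕ j) → φ (x ⊕ j) ≡ c → Sees P φ η c x
  via  : ∀ {x} j → P (x ⊕ j) → η x j ≡ c → Sees P φ η c (x ⊕ j) → Sees P φ η c x

sees-map : ∀ {m n n′} {P P′ : Q m → Set} {φ : Q m → Fin n} {η c} (f : Fin n → Fin n′) → P ≐ P′ →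
           ∀ {x} → Sees P φ η c x → Sees P′ (f ∘ φ) (λ p j → f (η p j)) (f c) x
sees-map f h (own e)        = own (cong f e)
sees-map f h (port j ∉ e)   = port j (∉ ∘ proj₂ h) (cong f e)
sees-map f h (via j ∈′ e s) = via j (proj₁ h ∈′) (cong f e) (sees-map f h s)

-- `φ` later also colours the vertices outside `P`, so a port belongs to the colour that leaves
-- there. `η` keeps apart the colours that pass between points of `P`.
record Labelling {m} n (P : Q m → Set) : Set where
  field
    φ     : Q m → Fin n
    η     : Q m → Fin m → Fin n
    η-sym : ∀ p j → η (p ⊕ j) j ≡ η p j
    sees  : ∀ {x} → P x → ∀ c → Sees P φ η c x

sees-walk : ∀ {m n} {P : Q m → Set} {φ : Q m → Fin n} {η c x} → P x → Sees P φ η c x →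
            ∃ λ w → Star (ClusterStep P φ η c) x w × φ w ≡ c
sees-walk x∈ (own e)      = _ , ε , e
sees-walk x∈ (port j ∉ e) =
  _ , (j , refl , inj₁ x∈ , inj₂ e , λ _ ∈′ → contradiction ∈′ ∉) ◅ ε , e
sees-walk x∈ (via j ∈′ e s) with sees-walk ∈′ s
... | w , ws , e′ = w , (j , refl , inj₁ x∈ , inj₁ ∈′ , λ _ _ → e) ◅ ws , e′

half : ∀ {m} → Bool → (Q (suc m) → Set) → Q m → Set
half b P w = P (b ∷ w)

sees-half : ∀ {m n n′ b} {P : Q (suc m) → Set} {P′ : Q m → Set} {φ : Q (suc m) → Fin n′}
  {φ′ : Q m → Fin n} {η η′ c} (f : Fin n → Fin n′) → half b P ≐ P′ →
  (∀ w → φ (b ∷ w) ≡ f (φ′ w)) → (∀ w j → η (b ∷ w) (suc j) ≡ f (η′ w j)) →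
  ∀ {w} → Sees P′ φ′ η′ c w → Sees P φ η (f c) (b ∷ w)
sees-half f h eφ eη (own e)      = own (trans (eφ _) (cong f e))
sees-half f h eφ eη (port j ∉ e) = port (suc j) (∉ ∘ proj₁ h) (trans (eφ _) (cong f e))
sees-half f h eφ eη (via j ∈′ e s) =
  via (suc j) (proj₂ h ∈′) (trans (eη _ j) (cong f e)) (sees-half f h eφ eη s)

module Glue {m} {X : Set} (b : Bool) (near far : Q m → X) where

  φ : Q (suc m) → X
  φ (c ∷ w) = pick (c ≟ᵇ b) (near w) (far w)

  φ-near : ∀ w → φ (b ∷ w) ≡ near w
  φ-near w = pick-yes (b ≟ᵇ b) refl

  φ-far : ∀ w → φ (not b ∷ w) ≡ far w
  φ-far w = pick-no (not b ≟ᵇ b) not-≢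

side : ∀ b c → c ≡ b ⊎ c ≡ not b
side b c with c ≟ᵇ b
... | yes e = inj₁ e
... | no ne = inj₂ (¬-not ne)

-- Common neighbours are labelled from u₁, which merely swaps two colours around u₂.
module Pair {m} (u₁ u₂ : Q m) (u₁≢u₂ : u₁ ≢ u₂) where

  private
    label : ∀ {w} → Dec (Edge u₁ w) → Dec (Edge u₂ w) → Fin (suc m)
    label (yes (j , _)) _             = suc j
    label (no _)        (yes (j , _)) = suc j
    label (no _)        (no _)        = zero

  ℓ : Q m → Fin (suc m)
  ℓ w = label (neighbour? u₁ w) (neighbour? u₂ w)

  ℓ-first : ∀ j → ℓ (u₁ ⊕ j) ≡ suc j
  ℓ-first j with neighbour? u₁ (u₁ ⊕ j)
  ... | yes (i , e) = cong suc (sym (⊕-injective u₁ e))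
  ... | no ¬e       = contradiction (j , refl) ¬e

  ℓ-second : ∀ j → ¬ Edge u₁ (u₂ ⊕ j) → ℓ (u₂ ⊕ j) ≡ suc j
  ℓ-second j ¬e with neighbour? u₁ (u₂ ⊕ j) | neighbour? u₂ (u₂ ⊕ j)
  ... | yes e | _           = contradiction e ¬e
  ... | no _  | yes (i , e) = cong suc (sym (⊕-injective u₂ e))
  ... | no _  | no ¬e′      = contradiction (j , refl) ¬e′

  ℓ-none : ∀ {w} → ¬ Edge u₁ w → ¬ Edge u₂ w → ℓ w ≡ zero
  ℓ-none {w} ¬e ¬e′ with neighbour? u₁ w | neighbour? u₂ w
  ... | yes e | _      = contradiction e ¬e
  ... | no _  | yes e  = contradiction e ¬e′
  ... | no _  | no _   = refl

  ℓ-some : ∀ {w} → Edge u₁ w ⊎ Edge u₂ w → ℓ w ≢ zero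
  ℓ-some {w} e with neighbour? u₁ w | neighbour? u₂ w
  ... | yes _ | _      = λ ()
  ... | no _  | yes _  = λ ()
  ... | no ¬e | no ¬e′ = λ _ → [ ¬e , ¬e′ ]′ e

  ℓ-reach : ∀ c → ∃ λ j → ℓ (u₂ ⊕ j) ≡ suc c
  ℓ-reach c with neighbour? u₁ (u₂ ⊕ c)
  ... | no ¬e = c , ℓ-second c ¬e
  ... | yes (i , e) = i , trans (cong ℓ (trans (cong (_⊕ i) (⊕-sym c (sym e)))
    (trans (⊕-comm (u₁ ⊕ i) c i) (cong (_⊕ c) (⊕-involutive u₁ i))))) (ℓ-first c)

  -- The direction joining an adjacent pair leads to no port; both points carry the label lost in
  -- this way and see it as their own.
  ℓ-edge : ∀ d → u₂ ≡ u₁ ⊕ d → ℓ u₁ ≡ suc d × ℓ u₂ ≡ suc d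
  ℓ-edge d refl = trans (cong ℓ e) (ℓ-second d λ (j , e′) → ⊕-≢ u₁ j (trans (sym e′) (sym e))) , ℓ-first d
    where
    e : u₁ ≡ u₁ ⊕ d ⊕ d
    e = ⊕-sym d refl

  ℓ-apart : ¬ Edge u₁ u₂ → ∀ {x} → x ∈ u₁ ∷ u₂ ∷ [] → ℓ x ≡ zero
  ℓ-apart ¬e (here refl) =
    ℓ-none (λ (j , e) → ⊕-≢ u₁ j (sym e)) (λ (j , e) → ¬e (j , ⊕-sym j e))
  ℓ-apart ¬e (there (here refl)) = ℓ-none ¬e (λ (j , e) → ⊕-≢ u₂ j (sym e))

  -- No edge within the pair is used, so `η` is arbitrary. Colour `zero` is left out: a nonadjacent
  -- pair has it by `ℓ-apart`, an adjacent one must get it from outside this cube.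
  ℓ-sees : ∀ {η} c {x} → x ∈ u₁ ∷ u₂ ∷ [] → Sees (_∈ u₁ ∷ u₂ ∷ []) ℓ η (suc c) x
  ℓ-sees c (here refl) with u₂ ≟ (u₁ ⊕ c)
  ... | yes e = own (proj₁ (ℓ-edge c e))
  ... | no ne = port c (λ { (here e) → ⊕-≢ u₁ c e ; (there (here e)) → ne (sym e) }) (ℓ-first c)
  ℓ-sees c (there (here refl)) with ℓ-reach c
  ... | j , e with u₁ ≟ (u₂ ⊕ j)
  ...   | yes refl = own (trans (proj₂ (ℓ-edge j (⊕-sym j refl)))
                      (trans (sym (proj₁ (ℓ-edge j (⊕-sym j refl)))) e))
  ...   | no ne = port j (λ { (here e′) → ne (sym e′) ; (there (here e′)) → ⊕-≢ u₂ j e′ }) e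

-- Makes `o` a possible centre: the paths ending at its neighbours leave with all labels. This is
-- how further clusters of the same class share a labelling.
Rainbow : ∀ {m} → (Q m → Fin m) → Q m → Set
Rainbow φ o = ∀ c → ∃ λ j → φ (o ⊕ j) ≡ c


-- Splitting a list by one bit, for positions and for vertices

module Parts {A X : Set} (mk : Bool → A → X)
  (mk-injective : ∀ {b c x y} → mk b x ≡ mk c y → b ≡ c × x ≡ y)
  (unmk : ∀ x → ∃₂ λ b a → x ≡ mk b a) where

  record Split (xs : List X) : Set where
    field
      part   : Bool → List A
      part⇔  : ∀ b → (λ a → mk b a ∈ xs) ≐ (_∈ part b)
      unique : ∀ b → Unique (part b)
      size   : length (part false) + length (part true) ≡ length xs

  split : ∀ xs → Unique xs → Split xs
  split [] _ = record
    { part = λ _ → [] ; part⇔ = λ _ → (λ ()) , λ () ; unique = λ _ → [] ; size = refl }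
  split (x ∷ xs) (x∉ ∷ u) with unmk x
  ... | b , a , refl = record
    { part = add b ; part⇔ = λ c → to b c , from b c ; unique = add-unique b x∉ ; size = add-size b }
    where
    open Split (split xs u)
    add : Bool → Bool → List A
    add false false = a ∷ part false
    add false true  = part true
    add true  false = part false
    add true  true  = a ∷ part true
    to : ∀ b c {y} → mk c y ∈ mk b a ∷ xs → y ∈ add b c
    to b c (here e) with mk-injective e
    to false false (here e) | refl , refl = here refl
    to true  true  (here e) | refl , refl = here refl
    to false false (there y∈) = there (proj₁ (part⇔ false) y∈)
    to false true  (there y∈) = proj₁ (part⇔ true) y∈
    to true  false (there y∈) = proj₁ (part⇔ false) y∈
    to true  true  (there y∈) = there (proj₁ (part⇔ true) y∈)
    from : ∀ b c {y} → y ∈ add b c → mk c y ∈ mk b a ∷ xs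
    from false false (here refl) = here refl
    from false false (there y∈)  = there (proj₂ (part⇔ false) y∈)
    from false true  y∈          = there (proj₂ (part⇔ true) y∈)
    from true  false y∈          = there (proj₂ (part⇔ false) y∈)
    from true  true  (here refl) = here refl
    from true  true  (there y∈)  = there (proj₂ (part⇔ true) y∈)
    fresh : ∀ {b} → All (mk b a ≢_) xs → All (a ≢_) (part b)
    fresh {b} h = ¬Any⇒All¬ _ (λ a∈ → All.lookup h (proj₂ (part⇔ b) a∈) refl)
    add-unique : ∀ b → All (mk b a ≢_) xs → ∀ c → Unique (add b c)
    add-unique false h false = fresh h ∷ unique false
    add-unique false h true  = unique true
    add-unique true  h false = unique false
    add-unique true  h true  = fresh h ∷ unique true
    add-size : ∀ b → length (add b false) + length (add b true) ≡ suc (length xs)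
    add-size false = cong suc size
    add-size true  = trans (+-suc _ _) (cong suc size)

∷-injective : ∀ {m b c} {p q : Q m} → b ∷ p ≡ c ∷ q → b ≡ c × p ≡ q
∷-injective refl = refl , refl

uncons : ∀ {m} (p : Q (suc m)) → ∃₂ λ b w → p ≡ b ∷ w
uncons (b ∷ w) = b , w , refl

module HeadBit {m : ℕ} = Parts {Q m} {Q (suc m)} _∷_ ∷-injective uncons

-- Labellings for two and three points

uncolour : ∀ {m} → Fin (suc (suc m)) → Fin (suc m)
uncolour zero    = zero
uncolour (suc j) = j

two : ∀ {m} {P : Q m → Set} {u₁ u₂} → P ≐ (_∈ u₁ ∷ u₂ ∷ []) → u₁ ≢ u₂ → Labelling m P
two {zero} {u₁ = []} {[]} _ u₁≢u₂ = contradiction refl u₁≢u₂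
two {suc m} {P} {u₁} {u₂} h u₁≢u₂ = record
  { φ = uncolour ∘ ℓ ; η = λ _ _ → zero ; η-sym = λ _ _ → refl
  ; sees = λ x∈ c → sees-map uncolour (≐-sym h) (ℓ-sees {λ _ _ → zero} c (proj₁ h x∈)) }
  where
  open Pair u₁ u₂ u₁≢u₂

-- The two centres may coincide, as two clusters can have points at the same position. If they
-- differ, the swap of colours around the second one is harmless, because only the set of labels
-- around it counts.
rainbow-two : ∀ {m} (u₁ u₂ : Q (suc m)) →
              ∃ λ (φ : Q (suc m) → Fin (suc m)) → Rainbow φ u₁ × Rainbow φ u₂
rainbow-two u₁ u₂ with u₁ ≟ u₂
... | yes refl = uncolour ∘ direction u₁ , r , r
  where
  r : Rainbow (uncolour ∘ direction u₁) u₁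
  r c = c , cong uncolour (direction-⊕ u₁ c)
... | no u₁≢u₂ = uncolour ∘ ℓ , (λ c → c , cong uncolour (ℓ-first c)) ,
  λ c → proj₁ (ℓ-reach c) , cong uncolour (proj₂ (ℓ-reach c))
  where
  open Pair u₁ u₂ u₁≢u₂

-- The additional colour `zero` fills the empty half, where every point has a neighbour.
lift-half : ∀ {m} b {P : Q (suc m) → Set} {P′ : Q m → Set} → half b P ≐ P′ →
  (∀ {w} → ¬ P (not b ∷ w)) → Labelling m P′ → Labelling (suc m) P
lift-half {m} b {P} {P′} h far∉ L = record { φ = φ ; η = η ; η-sym = η-sym ; sees = sees }
  where
  module L = Labelling L
  open Glue {X = Fin (suc m)} b (suc ∘ L.φ) (λ _ → zero)
  η : Q (suc m) → Fin (suc m) → Fin (suc m)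
  η w       zero    = zero
  η (c ∷ w) (suc j) = suc (L.η w j)
  η-sym : ∀ p j → η (p ⊕ j) j ≡ η p j
  η-sym (c ∷ w) zero    = refl
  η-sym (c ∷ w) (suc j) = cong suc (L.η-sym w j)
  sees : ∀ {x} → P x → ∀ c → Sees P φ η c x
  sees {d ∷ w} x∈ c with side b d
  sees {d ∷ w} x∈ c       | inj₂ refl = contradiction x∈ far∉
  sees {d ∷ w} x∈ zero    | inj₁ refl = port zero far∉ (φ-far w)
  sees {d ∷ w} x∈ (suc c) | inj₁ refl = sees-half suc h φ-near (λ _ _ → refl) (L.sees (proj₁ h x∈) c)

-- The rainbow position serves a fourth point that lies alone in another cluster of the same class.
Three : ∀ {m} → (Q m → Set) → Set
Three {m} P = Σ (Labelling m P) λ L → ∃ (Rainbow (Labelling.φ L))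

-- The far copy of `u₁` is labelled `zero`; `u₁` sees it directly, and `u₂`, if adjacent, through
-- the edge to `u₁`. If that copy is next to `v`, then `v` itself takes the label of the direction
-- it thereby loses, and otherwise `zero`.
three-split : ∀ {m} b {P : Q (suc m) → Set} {u₁ u₂ v} → half b P ≐ (_∈ u₁ ∷ u₂ ∷ []) →
  half (not b) P ≐ (_∈ v ∷ []) → u₁ ≢ u₂ → v ≢ u₁ → Three P
three-split {m} b {P} {u₁} {u₂} {v} hu hv u₁≢u₂ v≢u₁ =
  record { φ = φ ; η = η ; η-sym = λ _ _ → refl ; sees = sees } , b ∷ u₁ , rainbow
  where
  open Pair u₁ u₂ u₁≢u₂
  far : Q m → Fin (suc m)
  far w = pick (w ≟ u₁) zero (pick (w ≟ v) (pick (neighbour? v u₁) (direction v u₁) zero) (direction v w))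
  open Glue b ℓ far
  η : Q (suc m) → Fin (suc m) → Fin (suc m)
  η _ _ = zero
  far-u₁ : φ (not b ∷ u₁) ≡ zero
  far-u₁ = trans (φ-far u₁) (pick-yes (u₁ ≟ u₁) refl)
  far-v : φ (not b ∷ v) ≡ pick (neighbour? v u₁) (direction v u₁) zero
  far-v = trans (φ-far v) (trans (pick-no (v ≟ u₁) v≢u₁) (pick-yes (v ≟ v) refl))
  not-v : ∀ {w} → w ≢ v → ¬ P (not b ∷ w)
  not-v w≢v w∈ with proj₁ hv w∈
  ... | here e = w≢v e
  u₁-zero : Sees P φ η zero (b ∷ u₁)
  u₁-zero = port zero (not-v (v≢u₁ ∘ sym)) far-u₁
  v-zero : Dec (Edge v u₁) → Sees P φ η zero (not b ∷ v)
  v-zero (yes (j , e)) = port (suc j) (not-v (⊕-≢ v j)) (subst (λ w → φ (not b ∷ w) ≡ zero) e far-u₁)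
  v-zero (no ¬e)       = own (trans far-v (pick-no (neighbour? v u₁) ¬e))
  sees : ∀ {x} → P x → ∀ c → Sees P φ η c x
  sees {d ∷ w} x∈ c with side b d
  sees {d ∷ w} x∈ (suc c) | inj₁ refl = sees-half id hu φ-near (λ _ _ → refl) (ℓ-sees c (proj₁ hu x∈))
  sees {d ∷ w} x∈ zero | inj₁ refl with proj₁ hu x∈
  ... | here refl = u₁-zero
  ... | there (here refl) with neighbour? u₁ u₂
  ...   | no ¬e = own (trans (φ-near u₂) (ℓ-apart ¬e (there (here refl))))
  ...   | yes (j , e) = via (suc j) (subst (λ w → P (b ∷ w)) (⊕-sym j e) (proj₂ hu (here refl))) refl
            (subst (λ w → Sees P φ η zero (b ∷ w)) (⊕-sym j e) u₁-zero)
  sees {d ∷ w} x∈ c | inj₂ refl with proj₁ hv x∈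
  sees {d ∷ w} x∈ zero | inj₂ refl | here refl = v-zero (neighbour? v u₁)
  sees {d ∷ w} x∈ (suc c) | inj₂ refl | here refl with (v ⊕ c) ≟ u₁
  ... | yes refl = own (trans far-v (trans (pick-yes (neighbour? v u₁) (c , refl)) (direction-⊕ v c)))
  ... | no ne = port (suc c) (not-v (⊕-≢ v c)) (trans (φ-far (v ⊕ c)) (trans (pick-no (_ ≟ u₁) ne)
                  (trans (pick-no (_ ≟ v) (⊕-≢ v c)) (direction-⊕ v c))))
  rainbow : Rainbow φ (b ∷ u₁)
  rainbow zero    = zero , far-u₁
  rainbow (suc c) = suc c , trans (φ-near _) (ℓ-first c)

three-split′ : ∀ {m} b {P : Q (suc m) → Set} {us v} → half b P ≐ (_∈ us) → Unique us → length us ≡ 2 →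
  half (not b) P ≐ (_∈ v ∷ []) → Three P
three-split′ b {us = u₁ ∷ u₂ ∷ []} {v} hu ((u₁≢u₂ ∷ []) ∷ _) refl hv with v ≟ u₁
... | no v≢u₁  = three-split b hu hv u₁≢u₂ v≢u₁
... | yes refl = three-split b (≐-↭ (swap _ _ Permutation.refl) hu) hv (u₁≢u₂ ∘ sym) u₁≢u₂

Three-half : ∀ {m} b {P : Q (suc m) → Set} {P′ : Q m → Set} → half b P ≐ P′ →
  (∀ {w} → ¬ P (not b ∷ w)) → Three P′ → Three P
Three-half {m} b h far∉ (L , o , r) = lift-half b h far∉ L , b ∷ o , rainbow
  where
  open Glue {X = Fin (suc m)} b (suc ∘ Labelling.φ L) (λ _ → zero)
  rainbow : Rainbow φ (b ∷ o)
  rainbow zero    = zero , φ-far o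
  rainbow (suc c) = suc (proj₁ (r c)) , trans (φ-near _) (cong suc (proj₂ (r c)))

three : ∀ {m} (xs : List (Q m)) → Unique xs → length xs ≡ 3 → Three (_∈ xs)
three {zero} ([] ∷ [] ∷ _) ((ne ∷ _) ∷ _) _ = contradiction refl ne
three {suc m} xs u len = cases (part false) (part true) refl refl (trans size len)
  where
  open HeadBit.Split (HeadBit.split xs u)
  empty : ∀ b {w} → part b ≡ [] → b ∷ w ∉ xs
  empty b e w∈ with subst (_ ∈_) e (proj₁ (part⇔ b) w∈)
  ... | ()
  as : ∀ b {l} → part b ≡ l → (λ w → b ∷ w ∈ xs) ≐ (_∈ l)
  as b e = subst (λ l → (λ w → b ∷ w ∈ xs) ≐ (_∈ l)) e (part⇔ b)
  cases : ∀ us vs → part false ≡ us → part true ≡ vs → length us + length vs ≡ 3 → Three (_∈ xs)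
  cases [] vs eu refl len =
    Three-half true (part⇔ true) (empty false eu) (three vs (unique true) len)
  cases (v ∷ []) vs eu refl len =
    three-split′ true (part⇔ true) (unique true) (cong pred len) (as false eu)
  cases (_ ∷ _ ∷ []) (v ∷ []) eu ev _ =
    three-split′ false (part⇔ false) (unique false) (cong length eu) (as true ev)
  cases (_ ∷ _ ∷ _ ∷ []) [] eu ev _ =
    Three-half false (part⇔ false) (empty true ev) (three (part false) (unique false) (cong length eu))
  cases (_ ∷ _ ∷ []) [] _ _ ()
  cases (_ ∷ _ ∷ []) (_ ∷ _ ∷ _) _ _ ()

-- Four points, two in either half

module _ {m : ℕ} (b : Bool) {P : Q (suc m) → Set} {u₁ u₂ v₁ v₂ : Q m}
  (hu : half b P ≐ (_∈ u₁ ∷ u₂ ∷ [])) (hv : half (not b) P ≐ (_∈ v₁ ∷ v₂ ∷ []))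
  (u₁≢u₂ : u₁ ≢ u₂) (v₁≢v₂ : v₁ ≢ v₂) where

  private
    module U = Pair u₁ u₂ u₁≢u₂
    module V = Pair v₁ v₂ v₁≢v₂

  far∈ : ∀ {w} → P (not (not b) ∷ w) → w ∈ u₁ ∷ u₂ ∷ []
  far∈ {w} = proj₁ hu ∘ subst (λ c → P (c ∷ w)) (not-involutive b)

  -- An adjacent pair misses colour zero in its own half and finds it in the other
  -- one after relabelling: the colour A next to the first pair becomes zero, and
  -- zero becomes the colour B next to the second pair.
  four-relabelled : (A B : Fin (suc m)) → (A ≡ zero → B ≡ zero) → (B ≡ zero → A ≡ zero) →
    (∃ λ u → u ∈ u₁ ∷ u₂ ∷ [] × u ∉ v₁ ∷ v₂ ∷ [] × V.ℓ u ≡ A) ⊎ ¬ Edge u₁ u₂ →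
    (∃ λ v → v ∈ v₁ ∷ v₂ ∷ [] × v ∉ u₁ ∷ u₂ ∷ [] × U.ℓ v ≡ B) ⊎ ¬ Edge v₁ v₂ →
    Labelling (suc m) P
  four-relabelled A B A⇒B B⇒A linkU linkV =
    record { φ = φ ; η = η ; η-sym = η-sym ; sees = sees }
    where
    -- The cycle from `A` to `zero` to `B` and back to `A`; a transposition if `A` equals `B`, the
    -- identity if both are `zero`. If exactly one of them were `zero`, `σ` would not be onto, hence
    -- the hypotheses `A⇒B` and `B⇒A`.
    σ : Fin (suc m) → Fin (suc m)
    σ x = pick (x ≟ᶠ A) zero (pick (x ≟ᶠ zero) B (pick (x ≟ᶠ B) A x))
    σ-A : σ A ≡ zero
    σ-A = pick-yes (A ≟ᶠ A) refl
    σ-zero : σ zero ≡ B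
    σ-zero with zero ≟ᶠ A
    ... | yes e = sym (A⇒B (sym e))
    ... | no _  = refl
    σ-surjective : ∀ c → ∃ λ x → σ x ≡ c
    σ-surjective c with c ≟ᶠ zero | c ≟ᶠ B | c ≟ᶠ A
    ... | yes refl | _        | _        = A , σ-A
    ... | no _     | yes refl | _        = zero , σ-zero
    ... | no c≢0   | no c≢B   | yes refl = B , trans (pick-no (B ≟ᶠ A) (c≢B ∘ sym))
      (trans (pick-no (B ≟ᶠ zero) (c≢0 ∘ B⇒A)) (pick-yes (B ≟ᶠ B) refl))
    ... | no c≢0   | no c≢B   | no c≢A   = c , trans (pick-no (c ≟ᶠ A) c≢A)
      (trans (pick-no (c ≟ᶠ zero) c≢0) (pick-no (c ≟ᶠ B) c≢B))
    open Glue b U.ℓ (σ ∘ V.ℓ)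
    η : Q (suc m) → Fin (suc m) → Fin (suc m)
    η w       zero    = zero
    η (c ∷ w) (suc j) = pick (c ≟ᵇ b) zero B
    η-sym : ∀ p j → η (p ⊕ j) j ≡ η p j
    η-sym (c ∷ w) zero    = refl
    η-sym (c ∷ w) (suc j) = refl
    apart : ∀ {y z x w : Q m} → x ∈ y ∷ z ∷ [] → w ∈ y ∷ z ∷ [] → x ≢ w → ¬ Edge x w → ¬ Edge y z
    apart (here refl) (here refl) ne _ = contradiction refl ne
    apart (here refl) (there (here refl)) _ ¬e = ¬e
    apart (there (here refl)) (here refl) _ ¬e = λ (j , e) → ¬e (j , ⊕-sym j e)
    apart (there (here refl)) (there (here refl)) ne _ = contradiction refl ne
    spread : ∀ {c d y z} → half d P ≐ (_∈ y ∷ z ∷ []) → (∀ w j → η (d ∷ w) (suc j) ≡ c) →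
      (¬ Edge y z → ∀ {x} → x ∈ y ∷ z ∷ [] → Sees P φ η c (d ∷ x)) →
      ∀ {w} → w ∈ y ∷ z ∷ [] → Sees P φ η c (d ∷ w) → ∀ {x} → x ∈ y ∷ z ∷ [] → Sees P φ η c (d ∷ x)
    spread {c} {d} h eη alone {w} w∈ s {x} x∈ with x ≟ w | neighbour? x w
    ... | yes refl | _           = s
    ... | no x≢w   | no ¬e       = alone (apart x∈ w∈ x≢w ¬e) x∈
    ... | no _     | yes (j , e) = via (suc j) (subst (λ w → P (d ∷ w)) e (proj₂ h w∈)) (eη x j)
      (subst (λ w → Sees P φ η c (d ∷ w)) e s)
    near-zero : ∀ {x} → x ∈ u₁ ∷ u₂ ∷ [] → Sees P φ η zero (b ∷ x)
    near-zero = go linkU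
      where
      alone : ¬ Edge u₁ u₂ → ∀ {x} → x ∈ u₁ ∷ u₂ ∷ [] → Sees P φ η zero (b ∷ x)
      alone ¬e x∈ = own (trans (φ-near _) (U.ℓ-apart ¬e x∈))
      go : (∃ λ u → u ∈ u₁ ∷ u₂ ∷ [] × u ∉ v₁ ∷ v₂ ∷ [] × V.ℓ u ≡ A) ⊎ ¬ Edge u₁ u₂ →
           ∀ {x} → x ∈ u₁ ∷ u₂ ∷ [] → Sees P φ η zero (b ∷ x)
      go (inj₂ ¬e) = alone ¬e
      go (inj₁ (u , u∈ , u∉ , e)) = spread hu (λ _ _ → pick-yes (b ≟ᵇ b) refl) alone u∈
        (port zero (u∉ ∘ proj₁ hv) (trans (φ-far u) (trans (cong σ e) σ-A)))
    far-B : ∀ {x} → x ∈ v₁ ∷ v₂ ∷ [] → Sees P φ η B (not b ∷ x)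
    far-B = go linkV
      where
      alone : ¬ Edge v₁ v₂ → ∀ {x} → x ∈ v₁ ∷ v₂ ∷ [] → Sees P φ η B (not b ∷ x)
      alone ¬e x∈ = own (trans (φ-far _) (trans (cong σ (V.ℓ-apart ¬e x∈)) σ-zero))
      go : (∃ λ v → v ∈ v₁ ∷ v₂ ∷ [] × v ∉ u₁ ∷ u₂ ∷ [] × U.ℓ v ≡ B) ⊎ ¬ Edge v₁ v₂ →
           ∀ {x} → x ∈ v₁ ∷ v₂ ∷ [] → Sees P φ η B (not b ∷ x)
      go (inj₂ ¬e) = alone ¬e
      go (inj₁ (v , v∈ , v∉ , e)) = spread hv (λ _ _ → pick-no (not b ≟ᵇ b) not-≢) alone v∈
        (port zero (v∉ ∘ far∈) (trans (cong (λ c → φ (c ∷ v)) (not-involutive b)) (trans (φ-near v) e)))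
    sees : ∀ {x} → P x → ∀ c → Sees P φ η c x
    sees {d ∷ w} x∈ c with side b d
    sees {d ∷ w} x∈ zero    | inj₁ refl = near-zero (proj₁ hu x∈)
    sees {d ∷ w} x∈ (suc c) | inj₁ refl =
      sees-half id hu φ-near (λ _ _ → pick-yes (b ≟ᵇ b) refl) (U.ℓ-sees {λ _ _ → zero} c (proj₁ hu x∈))
    sees {d ∷ w} x∈ c       | inj₂ refl with σ-surjective c
    ... | zero  , e    = subst (λ c → Sees P φ η c _) (trans (sym σ-zero) e) (far-B (proj₁ hv x∈))
    ... | suc a , refl = sees-half σ hv φ-far
      (λ _ _ → trans (pick-no (not b ≟ᵇ b) not-≢) (sym σ-zero)) (V.ℓ-sees {λ _ _ → zero} a (proj₁ hv x∈))


_∈?_ : ∀ {m} (x : Q m) xs → Dec (x ∈ xs)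
_∈?_ = DecMembership._∈?_ _≟_

pair-exhausts : ∀ {A : Set} {a b x y z : A} → x ∈ a ∷ b ∷ [] → y ∈ a ∷ b ∷ [] → x ≢ y →
                z ∈ a ∷ b ∷ [] → z ≡ x ⊎ z ≡ y
pair-exhausts (here refl)         (here refl)         ne _ = contradiction refl ne
pair-exhausts (there (here refl)) (there (here refl)) ne _ = contradiction refl ne
pair-exhausts (here refl)         (there (here refl)) _ (here e)         = inj₁ e
pair-exhausts (here refl)         (there (here refl)) _ (there (here e)) = inj₂ e
pair-exhausts (there (here refl)) (here refl)         _ (here e)         = inj₂ e
pair-exhausts (there (here refl)) (here refl)         _ (there (here e)) = inj₁ e

Edge-sym : ∀ {m} {p q : Q m} → Edge p q → Edge q p
Edge-sym (j , e) = j , ⊕-sym j e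

pair-edge : ∀ {m} {a b x y : Q m} → Edge a b → x ∈ a ∷ b ∷ [] → y ∈ a ∷ b ∷ [] → x ≢ y → Edge x y
pair-edge e (here refl)         (here refl)         ne = contradiction refl ne
pair-edge e (there (here refl)) (there (here refl)) ne = contradiction refl ne
pair-edge e (here refl)         (there (here refl)) _  = e
pair-edge e (there (here refl)) (here refl)         _  = Edge-sym e

-- Both pairs then have the same points. So if one pair is adjacent and the other is not, some point
-- of the adjacent pair has its copy in the other half outside `P`.
edge-within : ∀ {m} {a b : Q m} {ys} → a ≢ b → ¬ Any (_∉ ys) (a ∷ b ∷ []) → Edge a b →
              ∀ {c d} → ys ≡ c ∷ d ∷ [] → Edge c d
edge-within {a = a} {b} {ys} a≢b none e refl with a ∈? ys | b ∈? ys
... | no a∉ | _     = contradiction (here a∉) none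
... | _     | no b∉ = contradiction (there (here b∉)) none
... | yes (here refl)         | yes (here refl)         = contradiction refl a≢b
... | yes (here refl)         | yes (there (here refl)) = e
... | yes (there (here refl)) | yes (here refl)         = Edge-sym e
... | yes (there (here refl)) | yes (there (here refl)) = contradiction refl a≢b

module _ {m : ℕ} (b : Bool) {P : Q (suc m) → Set} {u v : Q m} {d : Fin m}
  (h : ∀ s → half s P ≐ (_∈ u ∷ v ∷ [])) (v≡ : v ≡ u ⊕ d) where

  private
    u≢v : u ≢ v
    u≢v e = ⊕-≢ u d (sym (trans e v≡))

  open Pair u v u≢v

  -- `P` is a 4-cycle, so no copy in the other half is free. Opposite corners get the same label:
  -- each corner owns one of `zero` and `suc d` and takes the edge of the other direction to a
  -- corner owning the other. All remaining colours are ports.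
  four-square : Labelling (suc m) P
  four-square = record { φ = φ ; η = λ _ j → j ; η-sym = λ _ _ → refl ; sees = sees }
    where
    open Glue b (λ w → pick (w ≟ u) zero (ℓ w)) (λ w → pick (w ≟ v) zero (ℓ w))
    See : Fin (suc m) → Q (suc m) → Set
    See = Sees P φ (λ _ j → j)
    φ-other : ∀ s {w} → w ≢ u → w ≢ v → φ (s ∷ w) ≡ ℓ w
    φ-other s {w} w≢u w≢v with side b s
    ... | inj₁ refl = trans (φ-near w) (pick-no (w ≟ u) w≢u)
    ... | inj₂ refl = trans (φ-far w) (pick-no (w ≟ v) w≢v)
    ∉P : ∀ s {w} → w ≢ u → w ≢ v → ¬ P (s ∷ w)
    ∉P s w≢u w≢v w∈ with proj₁ (h s) w∈
    ... | here e         = w≢u e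
    ... | there (here e) = w≢v e
    u-port : ∀ s c → c ≢ d → See (suc c) (s ∷ u)
    u-port s c c≢d = port (suc c) (∉P s (⊕-≢ u c) ≢v) (trans (φ-other s (⊕-≢ u c) ≢v) (ℓ-first c))
      where
      ≢v : u ⊕ c ≢ v
      ≢v e = c≢d (⊕-injective u (trans e v≡))
    v-port : ∀ s c → c ≢ d → See (suc c) (s ∷ v)
    v-port s c c≢d = port (suc c) (∉P s ≢u (⊕-≢ v c)) (trans (φ-other s ≢u (⊕-≢ v c)) (ℓ-second c ¬e))
      where
      ≢u : v ⊕ c ≢ u
      ≢u e = c≢d (⊕-injective v (trans e (⊕-sym d v≡)))
      ¬e : ¬ Edge u (v ⊕ c)
      ¬e (j , e) = ⊕-parity-≢ c (trans (cong parity v≡) (trans (parity-⊕ u d) (sym (parity-⊕ u j)))) e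
    v∷ : ∀ s → P (s ∷ v)
    v∷ s = proj₂ (h s) (there (here refl))
    u∷ : ∀ s → P (s ∷ u)
    u∷ s = proj₂ (h s) (here refl)
    bu : φ (b ∷ u) ≡ zero
    bu = trans (φ-near u) (pick-yes (u ≟ u) refl)
    bv : φ (b ∷ v) ≡ suc d
    bv = trans (φ-near v) (trans (pick-no (v ≟ u) (u≢v ∘ sym)) (proj₂ (ℓ-edge d v≡)))
    fu : φ (not b ∷ u) ≡ suc d
    fu = trans (φ-far u) (trans (pick-no (u ≟ v) u≢v) (proj₁ (ℓ-edge d v≡)))
    fv : φ (not b ∷ v) ≡ zero
    fv = trans (φ-far v) (pick-yes (v ≟ v) refl)
    back : φ (not (not b) ∷ u) ≡ zero
    back = trans (cong (λ s → φ (s ∷ u)) (not-involutive b)) bu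
    sees : ∀ {x} → P x → ∀ c → See c x
    sees {s ∷ w} x∈ c with proj₁ (h s) x∈ | side b s
    sees _ zero | here refl | inj₁ refl = own bu
    sees _ zero | here refl | inj₂ refl = via zero (u∷ _) refl (own back)
    sees _ zero | there (here refl) | inj₁ refl = via zero (v∷ _) refl (own fv)
    sees _ zero | there (here refl) | inj₂ refl = own fv
    sees _ (suc c) | w∈ | _ with c ≟ᶠ d
    sees _ (suc c) | here refl         | _ | no c≢d = u-port _ c c≢d
    sees _ (suc c) | there (here refl) | _ | no c≢d = v-port _ c c≢d
    sees _ (suc c) | here refl | inj₁ refl | yes refl =
      via (suc c) (subst (λ w → P (b ∷ w)) v≡ (v∷ b)) refl
        (own (subst (λ w → φ (b ∷ w) ≡ suc c) v≡ bv))
    sees _ (suc c) | here refl | inj₂ refl | yes refl = own fu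
    sees _ (suc c) | there (here refl) | inj₁ refl | yes refl = own bv
    sees _ (suc c) | there (here refl) | inj₂ refl | yes refl =
      via (suc c) (subst (λ w → P (not b ∷ w)) (⊕-sym c v≡) (u∷ (not b))) refl
        (own (subst (λ w → φ (not b ∷ w) ≡ suc c) (⊕-sym c v≡) fu))

module _ {m : ℕ} (b : Bool) {P : Q (suc m) → Set} {u₁ u₂ v₁ v₂ : Q m}
  (hu : half b P ≐ (_∈ u₁ ∷ u₂ ∷ [])) (hv : half (not b) P ≐ (_∈ v₁ ∷ v₂ ∷ []))
  (u₁≢u₂ : u₁ ≢ u₂) (v₁≢v₂ : v₁ ≢ v₂) where

  private
    module U = Pair u₁ u₂ u₁≢u₂
    module V = Pair v₁ v₂ v₁≢v₂
    us vs : List (Q m)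
    us = u₁ ∷ u₂ ∷ []
    vs = v₁ ∷ v₂ ∷ []

  four-linked : ∀ {u v} → u ∈ us → u ∉ vs → v ∈ vs → v ∉ us →
    (V.ℓ u ≡ zero → U.ℓ v ≡ zero) → (U.ℓ v ≡ zero → V.ℓ u ≡ zero) → Labelling (suc m) P
  four-linked {u} {v} u∈ u∉ v∈ v∉ f g = four-relabelled b hu hv u₁≢u₂ v₁≢v₂ (V.ℓ u) (U.ℓ v) f g
    (inj₁ (u , u∈ , u∉ , refl)) (inj₁ (v , v∈ , v∉ , refl))

  touching : ∀ {a b w x : Q m} (ne : a ≢ b) → x ∈ a ∷ b ∷ [] → Edge x w → Pair.ℓ a b ne w ≢ zero
  touching ne (here refl)         e = Pair.ℓ-some _ _ ne (inj₁ e)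
  touching ne (there (here refl)) e = Pair.ℓ-some _ _ ne (inj₂ e)

  Touch : Q m → Set
  Touch u = u ∉ vs × Any (λ v → Edge v u) vs

  -- The aim is to make both linking labels nonzero. If `v` also lies in `us`, its partner in `vs`
  -- replaces it: it is adjacent to `v`, and it is not in `us`, because otherwise `us` and `vs`
  -- would have the same points and contain no `u`.
  four-touching : ∀ {u v} → Edge v₁ v₂ → u ∈ us → u ∉ vs → v ∈ vs → Edge v u → Labelling (suc m) P
  four-touching {u} {v} ev u∈ u∉ v∈ e with v ∈? us
  ... | no v∉ = four-linked u∈ u∉ v∈ v∉
    (λ z → contradiction z (touching v₁≢v₂ v∈ e)) (λ z → contradiction z (touching u₁≢u₂ u∈ (Edge-sym e)))
  ... | yes v∈us with Any.any? (λ x → ¬? (x ≟ v)) vs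
  ...   | no all≡ = contradiction (trans (same (here refl)) (sym (same (there (here refl))))) v₁≢v₂
    where
    same : ∀ {x} → x ∈ vs → x ≡ v
    same {x} x∈ with x ≟ v
    ... | yes e = e
    ... | no ne = contradiction (lose x∈ ne) all≡
  ...   | yes found with find found
  ...     | v′ , v′∈ , v′≢v = four-linked u∈ u∉ v′∈ v′∉
    (λ z → contradiction z (touching v₁≢v₂ v∈ e))
    (λ z → contradiction z (touching u₁≢u₂ v∈us (pair-edge ev v∈ v′∈ (v′≢v ∘ sym))))
    where
    v′∉ : v′ ∉ us
    v′∉ v′∈us with pair-exhausts v∈us v′∈us (v′≢v ∘ sym) u∈
    ... | inj₁ refl = u∉ v∈
    ... | inj₂ refl = u∉ v′∈

  -- Here both linking labels are `zero`. A common point of the pairs would be adjacent to `u` and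
  -- hence touch it, so the pairs are disjoint with no edge between their positions.
  four-apart : ∀ {u} → Edge u₁ u₂ → u ∈ us → u ∉ vs → ¬ Any Touch us → Labelling (suc m) P
  four-apart {u} eu u∈ u∉ none = four-linked u∈ u∉ (here refl) v₁∉
    (λ _ → U.ℓ-none (free (here refl)) (free (there (here refl))))
    (λ _ → V.ℓ-none (¬touch u∈ u∉ (here refl)) (¬touch u∈ u∉ (there (here refl))))
    where
    ¬touch : ∀ {x y} → x ∈ us → x ∉ vs → y ∈ vs → ¬ Edge y x
    ¬touch x∈ x∉ y∈ e = none (lose x∈ (x∉ , lose y∈ e))
    disjoint : ∀ {x} → x ∈ us → x ∉ vs
    disjoint {x} x∈ x∈vs = ¬touch u∈ u∉ x∈vs (pair-edge eu x∈ u∈ λ { refl → u∉ x∈vs })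
    v₁∉ : v₁ ∉ us
    v₁∉ v₁∈ = disjoint v₁∈ (here refl)
    free : ∀ {x} → x ∈ us → ¬ Edge x v₁
    free x∈ e = ¬touch x∈ (disjoint x∈) (here refl) (Edge-sym e)

  four-adjacent : Edge u₁ u₂ → Edge v₁ v₂ → Labelling (suc m) P
  four-adjacent eu@(d , e) ev with u₁ ∈? vs | u₂ ∈? vs | touch?
    where
    touch? : Dec (Any Touch us)
    touch? = Any.any? (λ u → ¬? (u ∈? vs) ×-dec Any.any? (λ v → neighbour? v u) vs) us
  ... | yes u₁∈ | yes u₂∈ | _ = four-square b halves e
    where
    hv′ : half (not b) P ≐ (_∈ us)
    hv′ = (λ x∈ → [ here , there ∘ here ]′ (pair-exhausts u₁∈ u₂∈ u₁≢u₂ (proj₁ hv x∈))) ,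
          (λ { (here refl) → proj₂ hv u₁∈ ; (there (here refl)) → proj₂ hv u₂∈ })
    halves : ∀ s → half s P ≐ (_∈ us)
    halves s with side b s
    ... | inj₁ refl = hu
    ... | inj₂ refl = hv′
  ... | _ | _ | yes touch with find touch
  ...   | u , u∈ , u∉ , t with find t
  ...     | v , v∈ , e′ = four-touching ev u∈ u∉ v∈ e′
  four-adjacent eu ev | no u∉ | _ | no none = four-apart eu (here refl) u∉ none
  four-adjacent eu ev | _ | no u∉ | no none = four-apart eu (there (here refl)) u∉ none

  four-split : Labelling (suc m) P
  four-split with neighbour? u₁ u₂ | neighbour? v₁ v₂
  ... | yes eu | yes ev = four-adjacent eu ev
  ... | no ¬eu | no ¬ev =
    four-relabelled b hu hv u₁≢u₂ v₁≢v₂ zero zero id id (inj₂ ¬eu) (inj₂ ¬ev)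
  ... | yes eu | no ¬ev with Any.any? (λ u → ¬? (u ∈? vs)) us
  ...   | yes found with find found
  -- The nonadjacent pair does not constrain `B`, so it is set equal to `A` and the conditions on
  -- zero become trivial.
  ...     | u , u∈ , u∉ = four-relabelled b hu hv u₁≢u₂ v₁≢v₂ (V.ℓ u) (V.ℓ u) id id
    (inj₁ (u , u∈ , u∉ , refl)) (inj₂ ¬ev)
  four-split | yes eu | no ¬ev | no none = contradiction (edge-within u₁≢u₂ none eu refl) ¬ev
  four-split | no ¬eu | yes ev with Any.any? (λ v → ¬? (v ∈? us)) vs
  ...   | yes found with find found
  ...     | v , v∈ , v∉ = four-relabelled b hu hv u₁≢u₂ v₁≢v₂ (U.ℓ v) (U.ℓ v) id id
    (inj₂ ¬eu) (inj₁ (v , v∈ , v∉ , refl))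
  four-split | no ¬eu | yes ev | no none = contradiction (edge-within v₁≢v₂ none ev refl) ¬eu

-- Stars: several neighbours of one vertex

-- Around the tip C ⊕ a i of a star the direction a k gets the colour a (op i k), so that
-- the tips i and k agree on their common neighbour.  For the Klein four-group this is the
-- 3-edge-colouring of the complete graph on four vertices.
module Tips {m N : ℕ} (C : Q m) (a : Fin N → Fin m) (a-injective : ∀ {i j} → a i ≡ a j → i ≡ j)
  (op : Fin N → Fin N → Fin N) (op-comm : ∀ i k → op i k ≡ op k i)
  (op-involutive : ∀ i k → op i (op i k) ≡ k) where

  turn : Fin N → Fin m → Fin m
  turn i c with any? (λ k → c ≟ᶠ a k)
  ... | yes (k , _) = a (op i k)
  ... | no _        = c

  turn-a : ∀ i k → turn i (a k) ≡ a (op i k)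
  turn-a i k with any? (λ k′ → a k ≟ᶠ a k′)
  ... | yes (k′ , e) = cong (λ k → a (op i k)) (sym (a-injective e))
  ... | no ¬e        = contradiction (k , refl) ¬e

  turn-other : ∀ i {c} → ¬ (∃ λ k → c ≡ a k) → turn i c ≡ c
  turn-other i {c} ¬e with any? (λ k → c ≟ᶠ a k)
  ... | yes e = contradiction e ¬e
  ... | no _  = refl

  turn-involutive : ∀ i c → turn i (turn i c) ≡ c
  turn-involutive i c = go (any? (λ k → c ≟ᶠ a k))
    where
    go : Dec (∃ λ k → c ≡ a k) → turn i (turn i c) ≡ c
    go (yes (k , refl)) = trans (cong (turn i) (turn-a i k))
      (trans (turn-a i (op i k)) (cong a (op-involutive i k)))
    go (no ¬e) = trans (cong (turn i) (turn-other i ¬e)) (turn-other i ¬e)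

  tip : Fin N → Q m
  tip i = C ⊕ a i

  look : Fin m → Q m → Fin m
  look d w with any? (λ i → neighbour? (tip i) w)
  ... | yes (i , c , _) = turn i c
  ... | no _            = d

  look-tip : ∀ d i {c} → c ≢ a i → look d (tip i ⊕ c) ≡ turn i c
  look-tip d i {c} c≢ with any? (λ k → neighbour? (tip k) (tip i ⊕ c))
  ... | no ¬e = contradiction (i , c , refl) ¬e
  ... | yes (k , c′ , e) with ⊕⊕-injective C (c≢ ∘ sym) e
  ...   | inj₁ ai≡ak with refl ← a-injective ai≡ak = cong (turn i) (sym (⊕-injective (tip i) e))
  ...   | inj₂ refl with ⊕-injective (C ⊕ a i) (trans e (⊕-comm C (a k) (a i)))
  ...     | refl = trans (turn-a k i) (trans (cong a (op-comm k i)) (sym (turn-a i k)))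

  tip-≢-tip⊕ : ∀ i k c → tip k ⊕ c ≢ tip i
  tip-≢-tip⊕ i k c = ⊕-parity-≢ c (trans (parity-⊕ C (a k)) (sym (parity-⊕ C (a i))))

  tip⊕-≢-centre : ∀ i {c} → c ≢ a i → tip i ⊕ c ≢ C
  tip⊕-≢-centre i {c} c≢ e = c≢ (⊕-injective (tip i) (trans e (⊕-sym (a i) refl)))

  turn-≢ : ∀ i → op i i ≡ i → ∀ {c} → c ≢ a i → turn i c ≢ a i
  turn-≢ i self {c} c≢ e =
    c≢ (trans (sym (turn-involutive i c)) (trans (cong (turn i) e) (trans (turn-a i i) (cong a self))))

  -- All neighbours of a tip have the parity of the centre and so are ports. The centre is a port
  -- common to all tips, which therefore must give it one colour: `op i i` may not depend on `i`.
  open-star : (o : Fin N) → (∀ i → op i i ≡ o) → ∀ {P : Q m → Set} → (∀ {x} → P x → ∃ λ i → x ≡ tip i) →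
              Labelling m P
  open-star o self {P} P⊆ = record
    { φ = look (a o) ; η = λ _ j → j ; η-sym = λ _ _ → refl ; sees = sees }
    where
    at-centre : ∀ i → look (a o) C ≡ a o
    at-centre i with any? (λ k → neighbour? (tip k) C)
    ... | no _ = refl
    ... | yes (k , c , e) with ⊕-injective (tip k) (trans (sym e) (⊕-sym (a k) refl))
    ...   | refl = trans (turn-a k k) (cong a (self k))
    label : ∀ i c → look (a o) (tip i ⊕ c) ≡ turn i c
    label i c with c ≟ᶠ a i
    ... | yes refl = trans (cong (look (a o)) (⊕-involutive C c))
      (trans (at-centre i) (sym (trans (turn-a i i) (cong a (self i)))))
    ... | no c≢ = look-tip (a o) i c≢
    sees : ∀ {x} → P x → ∀ c → Sees P (look (a o)) (λ _ j → j) c x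
    sees x∈ c with P⊆ x∈
    ... | i , refl = port (turn i c) (λ w∈ → tip-≢-tip⊕ _ i _ (proj₂ (P⊆ w∈)))
      (trans (label i (turn i c)) (turn-involutive i c))

  -- With the centre in `P`, a tip loses the direction `a i` and owns that colour instead, while the
  -- centre reaches it through the edge to the tip. Since `op i i ≡ i`, the remaining directions of
  -- the tip are permuted among themselves.
  closed-star : (o : Fin N) → (∀ i → op i i ≡ i) → ∀ {P : Q m → Set} →
                (∀ {x} → P x → x ≡ C ⊎ ∃ λ i → x ≡ tip i) →
                (∀ i → P (tip i)) → Labelling m P
  closed-star o self {P} P⊆ tip∈ = record
    { φ = φ ; η = λ _ j → j ; η-sym = λ _ _ → refl ; sees = sees }
    where
    near : ∀ {w} → Dec (Edge C w) → Fin m → Fin m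
    near (yes (j , _)) _ = j
    near (no _)        d = d
    φ : Q m → Fin m
    φ w = near (neighbour? C w) (look (a o) w)
    near-edge : ∀ {w} j (d : Dec (Edge C w)) {x} → w ≡ C ⊕ j → near d x ≡ j
    near-edge j (yes (i , e)) e′ = ⊕-injective C (trans (sym e) e′)
    near-edge j (no ¬e)       e′ = contradiction (j , e′) ¬e
    near-far : ∀ {w} (d : Dec (Edge C w)) {x} → ¬ Edge C w → near d x ≡ x
    near-far (yes e) ¬e = contradiction e ¬e
    near-far (no _)  _  = refl
    φ-edge : ∀ j → φ (C ⊕ j) ≡ j
    φ-edge j = near-edge j (neighbour? C (C ⊕ j)) refl
    φ-far : ∀ i {c} → c ≢ a i → φ (tip i ⊕ c) ≡ turn i c
    φ-far i {c} c≢ = trans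
      (near-far (neighbour? C (tip i ⊕ c)) (λ (j , e) → tip-parity j (sym e)))
      (look-tip (a o) i c≢)
      where
      tip-parity : ∀ j → C ⊕ j ≢ tip i ⊕ c
      tip-parity j = ⊕-parity-≢ j (sym (trans (parity-⊕ (tip i) c)
        (trans (cong not (parity-⊕ C (a i))) (not-involutive _))))
    C-port : ∀ {c} → ¬ (∃ λ i → c ≡ a i) → ¬ P (C ⊕ c)
    C-port {c} ¬e w∈ with P⊆ w∈
    ... | inj₁ e       = ⊕-≢ C c e
    ... | inj₂ (i , e) = ¬e (i , ⊕-injective C e)
    tip-port : ∀ i {c} → c ≢ a i → ¬ P (tip i ⊕ c)
    tip-port i c≢ w∈ with P⊆ w∈
    ... | inj₁ e       = tip⊕-≢-centre i c≢ e
    ... | inj₂ (k , e) = tip-≢-tip⊕ k i _ e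
    sees : ∀ {x} → P x → ∀ c → Sees P φ (λ _ j → j) c x
    sees x∈ c with P⊆ x∈
    sees x∈ c | inj₁ refl with any? (λ i → c ≟ᶠ a i)
    ... | yes (i , refl) = via (a i) (tip∈ i) refl (own (φ-edge (a i)))
    ... | no ¬e          = port c (C-port ¬e) (φ-edge c)
    sees x∈ c | inj₂ (i , refl) with c ≟ᶠ a i
    ... | yes refl = own (φ-edge c)
    ... | no c≢    = port (turn i c) (tip-port i (turn-≢ i (self i) c≢))
      (trans (φ-far i (turn-≢ i (self i) c≢)) (turn-involutive i c))

klein : Fin 4 → Fin 4 → Fin 4
klein zero                   j                      = j
klein (suc zero)             zero                   = suc zero
klein (suc zero)             (suc zero)             = zero
klein (suc zero)             (suc (suc zero))       = suc (suc (suc zero))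
klein (suc zero)             (suc (suc (suc zero))) = suc (suc zero)
klein (suc (suc zero))       zero                   = suc (suc zero)
klein (suc (suc zero))       (suc zero)             = suc (suc (suc zero))
klein (suc (suc zero))       (suc (suc zero))       = zero
klein (suc (suc zero))       (suc (suc (suc zero))) = suc zero
klein (suc (suc (suc zero))) zero                   = suc (suc (suc zero))
klein (suc (suc (suc zero))) (suc zero)             = suc (suc zero)
klein (suc (suc (suc zero))) (suc (suc zero))       = suc zero
klein (suc (suc (suc zero))) (suc (suc (suc zero))) = zero

klein-comm : ∀ i k → klein i k ≡ klein k i
klein-comm = toWitness {a? = all? λ i → all? λ k → klein i k ≟ᶠ klein k i} _

klein-involutive : ∀ i k → klein i (klein i k) ≡ k
klein-involutive = toWitness {a? = all? λ i → all? λ k → klein i (klein i k) ≟ᶠ k} _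

klein-self : ∀ i → klein i i ≡ zero
klein-self = toWitness {a? = all? λ i → klein i i ≟ᶠ zero} _

-- Minus the sum modulo 3, the idempotent counterpart of `klein`.
third : Fin 3 → Fin 3 → Fin 3
third zero             zero             = zero
third zero             (suc zero)       = suc (suc zero)
third zero             (suc (suc zero)) = suc zero
third (suc zero)       zero             = suc (suc zero)
third (suc zero)       (suc zero)       = suc zero
third (suc zero)       (suc (suc zero)) = zero
third (suc (suc zero)) zero             = suc zero
third (suc (suc zero)) (suc zero)       = zero
third (suc (suc zero)) (suc (suc zero)) = suc (suc zero)

third-comm : ∀ i k → third i k ≡ third k i
third-comm = toWitness {a? = all? λ i → all? λ k → third i k ≟ᶠ third k i} _

third-involutive : ∀ i k → third i (third i k) ≡ k
third-involutive = toWitness {a? = all? λ i → all? λ k → third i (third i k) ≟ᶠ k} _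

third-self : ∀ i → third i i ≡ i
third-self = toWitness {a? = all? λ i → third i i ≟ᶠ i} _

-- Four points, three in one half

module _ {m : ℕ} (b : Bool) {P : Q (suc m) → Set} {us : List (Q m)} {v : Q m}
  (hu : half b P ≐ (_∈ us)) (hv : half (not b) P ≐ (_∈ v ∷ [])) (L : Labelling m (_∈ us)) where

  private
    module L = Labelling L

  -- The points of us meet the extra colour zero in the other half.
  four-extra : (o : Fin (suc m)) (τ : Fin m → Fin m) → o ≡ zero ⊎ (∃ λ j → v ⊕ j ∈ us) →
    (∀ c → (∃ λ j → v ⊕ j ∉ us × τ j ≡ c) ⊎ o ≡ suc c ⊎ (v ∉ us × L.φ v ≡ c)) →
    Labelling (suc m) P
  four-extra o τ zero-ok suc-ok = record { φ = φ ; η = η ; η-sym = η-sym ; sees = sees }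
    where
    turned : Fin (suc m) → Fin (suc m)
    turned zero    = zero
    turned (suc j) = suc (τ j)
    far : Q m → Fin (suc m)
    far w = pick (w ≟ v) o (pick (w ∈? us) zero (turned (direction v w)))
    open Glue {X = Fin (suc m)} b (suc ∘ L.φ) far
    η : Q (suc m) → Fin (suc m) → Fin (suc m)
    η w       zero    = zero
    η (c ∷ w) (suc j) = suc (L.η w j)
    η-sym : ∀ p j → η (p ⊕ j) j ≡ η p j
    η-sym (c ∷ w) zero    = refl
    η-sym (c ∷ w) (suc j) = cong suc (L.η-sym w j)
    only-v : ∀ {w} → w ≢ v → ¬ P (not b ∷ w)
    only-v w≢v w∈ with proj₁ hv w∈
    ... | here e = w≢v e
    far-v : φ (not b ∷ v) ≡ o
    far-v = trans (φ-far v) (pick-yes (v ≟ v) refl)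
    far-us : ∀ {w} → w ≢ v → w ∈ us → φ (not b ∷ w) ≡ zero
    far-us {w} w≢v w∈ = trans (φ-far w) (trans (pick-no (w ≟ v) w≢v) (pick-yes (w ∈? us) w∈))
    far-⊕ : ∀ j → v ⊕ j ∉ us → φ (not b ∷ v ⊕ j) ≡ suc (τ j)
    far-⊕ j w∉ = trans (φ-far (v ⊕ j)) (trans (pick-no (_ ≟ v) (⊕-≢ v j))
      (trans (pick-no (_ ∈? us) w∉) (cong turned (direction-⊕ v j))))
    v-zero : Sees P φ η zero (not b ∷ v)
    v-zero = [ (λ e → own (trans far-v e)) ,
               (λ (j , w∈) → port (suc j) (only-v (⊕-≢ v j)) (far-us (⊕-≢ v j) w∈)) ]′ zero-ok
    v-suc : ∀ c → Sees P φ η (suc c) (not b ∷ v)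
    v-suc c with suc-ok c
    ... | inj₁ (j , w∉ , refl)   = port (suc j) (only-v (⊕-≢ v j)) (far-⊕ j w∉)
    ... | inj₂ (inj₁ e)          = own (trans far-v e)
    ... | inj₂ (inj₂ (v∉ , e))   = port zero
      (v∉ ∘ proj₁ hu ∘ subst (λ c → P (c ∷ v)) (not-involutive b))
      (trans (cong (λ c → φ (c ∷ v)) (not-involutive b)) (trans (φ-near v) (cong suc e)))
    sees : ∀ {x} → P x → ∀ c → Sees P φ η c x
    sees {d ∷ w} x∈ c with side b d
    sees {d ∷ w} x∈ (suc c) | inj₁ refl = sees-half suc hu φ-near (λ _ _ → refl) (L.sees (proj₁ hu x∈) c)
    sees {d ∷ w} x∈ zero    | inj₁ refl with w ≟ v
    ... | yes refl = via zero (proj₂ hv (here refl)) refl v-zero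
    ... | no w≢v   = port zero (only-v w≢v) (far-us w≢v (proj₁ hu x∈))
    sees {d ∷ w} x∈ c       | inj₂ refl with proj₁ hv x∈
    sees {d ∷ w} x∈ zero    | inj₂ refl | here refl = v-zero
    sees {d ∷ w} x∈ (suc c) | inj₂ refl | here refl = v-suc c

  four-isolated : (∀ j → v ⊕ j ∉ us) → Labelling (suc m) P
  four-isolated ∉us = four-extra zero id (inj₁ refl) (λ c → inj₁ (c , ∉us c , refl))

  -- Each neighbour of `v` in `us` is spent on colour `zero`, so `v` loses at most two colours. It
  -- owns one of them; the near copy of `v`, when outside `us`, provides the other.
  four-near : (j₁ j₂ : Fin m) → v ⊕ j₁ ∈ us → (∀ j → v ⊕ j ∈ us → j ≡ j₁ ⊎ j ≡ j₂) →
    v ∉ us ⊎ j₁ ≡ j₂ → Labelling (suc m) P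
  four-near j₁ j₂ j₁∈ only ok = four-extra (suc (τ j₁)) τ (inj₂ (j₁ , j₁∈)) suc-ok
    where
    τ : Fin m → Fin m
    -- The near copy of `v` already has the label `L.φ v`, so exactly this colour is assigned to the
    -- direction `j₂` lost.
    τ = transpose j₂ (L.φ v)
    τ-j₂ : τ j₂ ≡ L.φ v
    τ-j₂ = trans (cong τ (sym matched)) (transpose-inverse j₂ (L.φ v))
      where
      matched : transpose (L.φ v) j₂ (L.φ v) ≡ j₂
      matched with L.φ v ≟ᶠ L.φ v
      ... | yes _ = refl
      ... | no ne = contradiction refl ne
    suc-ok : ∀ c → (∃ λ j → v ⊕ j ∉ us × τ j ≡ c) ⊎ suc (τ j₁) ≡ suc c ⊎ (v ∉ us × L.φ v ≡ c)
    suc-ok c = go (transpose (L.φ v) j₂ c) (transpose-inverse j₂ (L.φ v))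
      where
      go : ∀ j → τ j ≡ c → (∃ λ j → v ⊕ j ∉ us × τ j ≡ c) ⊎ suc (τ j₁) ≡ suc c ⊎ (v ∉ us × L.φ v ≡ c)
      go j e with (v ⊕ j) ∈? us
      ... | no w∉ = inj₁ (j , w∉ , e)
      ... | yes w∈ with only j w∈
      ...   | inj₁ refl = inj₂ (inj₁ (cong suc e))
      ...   | inj₂ refl = inj₂ ([ (λ v∉ → inj₂ (v∉ , trans (sym τ-j₂) e)) ,
                                  (λ j₁≡j₂ → inj₁ (cong suc (trans (cong τ j₁≡j₂) e))) ]′ ok)

module _ {m : ℕ} (b : Bool) {P : Q (suc m) → Set} where

  four-one : ∀ {u₁ u₂ u₃ v} → half b P ≐ (_∈ u₁ ∷ u₂ ∷ u₃ ∷ []) → half (not b) P ≐ (_∈ v ∷ []) →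
    Unique (u₁ ∷ u₂ ∷ u₃ ∷ []) → Edge v u₁ → ¬ Edge v u₂ → ¬ Edge v u₃ → Labelling (suc m) P
  four-one {u₁} {u₂} {u₃} {v} hu hv u (j₁ , e₁) ¬e₂ ¬e₃ =
    four-near b hu hv (proj₁ (three _ u refl)) j₁ j₁ (here (sym e₁)) only (inj₂ refl)
    where
    only : ∀ j → v ⊕ j ∈ u₁ ∷ u₂ ∷ u₃ ∷ [] → j ≡ j₁ ⊎ j ≡ j₁
    only j (here e)                 = inj₁ (⊕-injective v (trans e e₁))
    only j (there (here e))         = contradiction (j , sym e) ¬e₂
    only j (there (there (here e))) = contradiction (j , sym e) ¬e₃

  -- If `v` equals `u₃`, its near copy is no port. But then `b ∷ v` is a point of `P` adjacent to
  -- the other three, a closed star.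
  four-two : ∀ {u₁ u₂ u₃ v} → half b P ≐ (_∈ u₁ ∷ u₂ ∷ u₃ ∷ []) → half (not b) P ≐ (_∈ v ∷ []) →
    Unique (u₁ ∷ u₂ ∷ u₃ ∷ []) → Edge v u₁ → Edge v u₂ → ¬ Edge v u₃ → Labelling (suc m) P
  four-two {u₁} {u₂} {u₃} {v} hu hv u@((u₁≢u₂ ∷ _) ∷ _) (j₁ , e₁) (j₂ , e₂) ¬e₃ with v ≟ u₃
  ... | no v≢u₃ = four-near b hu hv (proj₁ (three _ u refl)) j₁ j₂ (here (sym e₁)) only (inj₁ v∉)
    where
    only : ∀ j → v ⊕ j ∈ u₁ ∷ u₂ ∷ u₃ ∷ [] → j ≡ j₁ ⊎ j ≡ j₂
    only j (here e)                 = inj₁ (⊕-injective v (trans e e₁))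
    only j (there (here e))         = inj₂ (⊕-injective v (trans e e₂))
    only j (there (there (here e))) = contradiction (j , sym e) ¬e₃
    v∉ : v ∉ u₁ ∷ u₂ ∷ u₃ ∷ []
    v∉ (here e)                 = ⊕-≢ v j₁ (sym (trans e e₁))
    v∉ (there (here e))         = ⊕-≢ v j₂ (sym (trans e e₂))
    v∉ (there (there (here e))) = v≢u₃ e
  ... | yes refl =
    Tips.closed-star (b ∷ v) a a-injective third third-comm third-involutive zero third-self P⊆ tip∈
    where
    a : Fin 3 → Fin (suc m)
    a zero             = zero
    a (suc zero)       = suc j₁
    a (suc (suc zero)) = suc j₂
    j₁≢j₂ : j₁ ≢ j₂
    j₁≢j₂ refl = u₁≢u₂ (trans e₁ (sym e₂))
    a-injective : ∀ {i j} → a i ≡ a j → i ≡ j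
    a-injective {zero}         {zero}         _ = refl
    a-injective {zero}         {suc zero}       ()
    a-injective {zero}         {suc (suc zero)} ()
    a-injective {suc zero}     {suc zero}     _ = refl
    a-injective {suc (suc zero)} {suc (suc zero)} _ = refl
    a-injective {suc zero}     {suc (suc zero)} e = contradiction (suc-injective e) j₁≢j₂
    a-injective {suc (suc zero)} {suc zero}   e = contradiction (sym (suc-injective e)) j₁≢j₂
    P⊆ : ∀ {x} → P x → x ≡ b ∷ v ⊎ ∃ λ i → x ≡ (b ∷ v) ⊕ a i
    P⊆ {d ∷ w} x∈ with side b d
    ... | inj₁ refl with proj₁ hu x∈
    ...   | here refl                 = inj₂ (suc zero , cong (b ∷_) e₁)
    ...   | there (here refl)         = inj₂ (suc (suc zero) , cong (b ∷_) e₂)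
    ...   | there (there (here refl)) = inj₁ refl
    P⊆ {d ∷ w} x∈ | inj₂ refl with proj₁ hv x∈
    ...   | here refl = inj₂ (zero , refl)
    tip∈ : ∀ i → P ((b ∷ v) ⊕ a i)
    tip∈ zero             = proj₂ hv (here refl)
    tip∈ (suc zero)       = proj₂ hu (here (sym e₁))
    tip∈ (suc (suc zero)) = proj₂ hu (there (here (sym e₂)))

  -- Three lost colours exceed the two replacements of `four-near`, but the points are then four
  -- neighbours of `b ∷ v`.
  four-three : ∀ {u₁ u₂ u₃ v} → half b P ≐ (_∈ u₁ ∷ u₂ ∷ u₃ ∷ []) → half (not b) P ≐ (_∈ v ∷ []) →
    Unique (u₁ ∷ u₂ ∷ u₃ ∷ []) → Edge v u₁ → Edge v u₂ → Edge v u₃ → Labelling (suc m) P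
  four-three {u₁} {u₂} {u₃} {v} hu hv ((u₁≢u₂ ∷ u₁≢u₃ ∷ _) ∷ (u₂≢u₃ ∷ _) ∷ _) (j₁ , e₁) (j₂ , e₂) (j₃ , e₃) =
    Tips.open-star (b ∷ v) a a-injective klein klein-comm klein-involutive zero klein-self P⊆
    where
    a : Fin 4 → Fin (suc m)
    a zero                   = zero
    a (suc zero)             = suc j₁
    a (suc (suc zero))       = suc j₂
    a (suc (suc (suc zero))) = suc j₃
    apart : ∀ {x y i j} → x ≢ y → x ≡ v ⊕ i → y ≡ v ⊕ j → suc i ≢ suc j
    apart x≢y e e′ refl = x≢y (trans e (sym e′))
    a-injective : ∀ {i j} → a i ≡ a j → i ≡ j
    a-injective {zero}                 {zero}                 _ = refl
    a-injective {zero}                 {suc zero}             ()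
    a-injective {zero}                 {suc (suc zero)}       ()
    a-injective {zero}                 {suc (suc (suc zero))} ()
    a-injective {suc zero}             {suc zero}             _ = refl
    a-injective {suc (suc zero)}       {suc (suc zero)}       _ = refl
    a-injective {suc (suc (suc zero))} {suc (suc (suc zero))} _ = refl
    a-injective {suc zero}             {suc (suc zero)}       e = contradiction e (apart u₁≢u₂ e₁ e₂)
    a-injective {suc (suc zero)}       {suc zero}             e = contradiction (sym e) (apart u₁≢u₂ e₁ e₂)
    a-injective {suc zero}             {suc (suc (suc zero))} e = contradiction e (apart u₁≢u₃ e₁ e₃)
    a-injective {suc (suc (suc zero))} {suc zero}             e = contradiction (sym e) (apart u₁≢u₃ e₁ e₃)
    a-injective {suc (suc zero)}       {suc (suc (suc zero))} e = contradiction e (apart u₂≢u₃ e₂ e₃)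
    a-injective {suc (suc (suc zero))} {suc (suc zero)}       e = contradiction (sym e) (apart u₂≢u₃ e₂ e₃)
    P⊆ : ∀ {x} → P x → ∃ λ i → x ≡ (b ∷ v) ⊕ a i
    P⊆ {d ∷ w} x∈ with side b d
    ... | inj₁ refl with proj₁ hu x∈
    ...   | here refl                 = suc zero , cong (b ∷_) e₁
    ...   | there (here refl)         = suc (suc zero) , cong (b ∷_) e₂
    ...   | there (there (here refl)) = suc (suc (suc zero)) , cong (b ∷_) e₃
    P⊆ {d ∷ w} x∈ | inj₂ refl with proj₁ hv x∈
    ...   | here refl = zero , refl

  four-3-1 : ∀ {us v} → half b P ≐ (_∈ us) → Unique us → length us ≡ 3 → half (not b) P ≐ (_∈ v ∷ []) →
             Labelling (suc m) P
  four-3-1 {u₁ ∷ u₂ ∷ u₃ ∷ []} {v} hu u refl hv with neighbour? v u₁ | neighbour? v u₂ | neighbour? v u₃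
  ... | yes e₁ | yes e₂ | yes e₃ = four-three hu hv u e₁ e₂ e₃
  ... | yes e₁ | yes e₂ | no ¬e₃ = four-two hu hv u e₁ e₂ ¬e₃
  ... | yes e₁ | no ¬e₂ | no ¬e₃ = four-one hu hv u e₁ ¬e₂ ¬e₃
  ... | yes e₁ | no ¬e₂ | yes e₃ = four-two (≐-↭ p hu) hv (Unique-↭ p u) e₁ e₃ ¬e₂
    where
    p = prep u₁ (swap u₂ u₃ Permutation.refl)
  ... | no ¬e₁ | yes e₂ | no ¬e₃ = four-one (≐-↭ p hu) hv (Unique-↭ p u) e₂ ¬e₁ ¬e₃
    where
    p = swap u₁ u₂ Permutation.refl
  ... | no ¬e₁ | yes e₂ | yes e₃ = four-two (≐-↭ p hu) hv (Unique-↭ p u) e₂ e₃ ¬e₁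
    where
    p = ++-comm (u₁ ∷ []) (u₂ ∷ u₃ ∷ [])
  ... | no ¬e₁ | no ¬e₂ | yes e₃ = four-one (≐-↭ p hu) hv (Unique-↭ p u) e₃ ¬e₁ ¬e₂
    where
    p = shift u₃ (u₁ ∷ u₂ ∷ []) []
  ... | no ¬e₁ | no ¬e₂ | no ¬e₃ = four-isolated b hu hv (proj₁ (three _ u refl)) ∉us
    where
    ∉us : ∀ j → v ⊕ j ∉ u₁ ∷ u₂ ∷ u₃ ∷ []
    ∉us j (here e)                 = ¬e₁ (j , sym e)
    ∉us j (there (here e))         = ¬e₂ (j , sym e)
    ∉us j (there (there (here e))) = ¬e₃ (j , sym e)

four : ∀ {m} (xs : List (Q m)) → Unique xs → length xs ≡ 4 → Labelling m (_∈ xs)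
four {zero} ([] ∷ [] ∷ _) ((ne ∷ _) ∷ _) _ = contradiction refl ne
four {suc m} xs u len = cases (part false) (part true) refl refl (trans size len)
  where
  open HeadBit.Split (HeadBit.split xs u)
  empty : ∀ b {w} → part b ≡ [] → b ∷ w ∉ xs
  empty b e w∈ with subst (_ ∈_) e (proj₁ (part⇔ b) w∈)
  ... | ()
  as : ∀ b {l} → part b ≡ l → (λ w → b ∷ w ∈ xs) ≐ (_∈ l)
  as b e = subst (λ l → (λ w → b ∷ w ∈ xs) ≐ (_∈ l)) e (part⇔ b)
  cases : ∀ us vs → part false ≡ us → part true ≡ vs → length us + length vs ≡ 4 → Labelling (suc m) (_∈ xs)
  cases [] vs eu refl len = lift-half true (part⇔ true) (empty false eu) (four vs (unique true) len)
  cases (v ∷ []) vs eu refl len = four-3-1 true (part⇔ true) (unique true) (cong pred len) (as false eu)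
  cases (u₁ ∷ u₂ ∷ []) (v₁ ∷ v₂ ∷ []) eu ev _
    with subst Unique eu (unique false) | subst Unique ev (unique true)
  ... | (≢u ∷ _) ∷ _ | (≢v ∷ _) ∷ _ = four-split false (as false eu) (as true ev) ≢u ≢v
  cases (u₁ ∷ u₂ ∷ u₃ ∷ []) (v ∷ []) eu ev _ =
    four-3-1 false (part⇔ false) (unique false) (cong length eu) (as true ev)
  cases (u₁ ∷ u₂ ∷ u₃ ∷ u₄ ∷ []) [] eu ev _ =
    lift-half false (part⇔ false) (empty true ev) (four (part false) (unique false) (cong length eu))
  cases (_ ∷ _ ∷ []) [] _ _ ()
  cases (_ ∷ _ ∷ []) (_ ∷ []) _ _ ()
  cases (_ ∷ _ ∷ []) (_ ∷ _ ∷ _ ∷ _) _ _ ()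
  cases (_ ∷ _ ∷ _ ∷ []) [] _ _ ()
  cases (_ ∷ _ ∷ _ ∷ []) (_ ∷ _ ∷ _) _ _ ()

-- Packings by the distribution of S over the clusters

record Solution {m} (φ : Q m → Fin m) (P : Q m → Set) : Set where
  field
    ψ     : Q m → Fin m
    η     : Q m → Fin m → Fin m
    η-sym : ∀ p j → η (p ⊕ j) j ≡ η p j
    leave : ∀ {p} → P p → ∀ c →
            ∃ λ w → Star (ClusterStep P ψ η c) p w × ClusterIn P ψ c w × φ w ≡ c

labelled-solution : ∀ {m} {P P′ : Q m → Set} → P ≐ P′ → (L : Labelling m P′) → Solution (Labelling.φ L) P
labelled-solution h L = record
  { ψ = φ ; η = η ; η-sym = η-sym
  ; leave = λ p∈ c → out (sees-walk p∈ (sees-map id (≐-sym h) (sees (proj₁ h p∈) c))) }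
  where
  open Labelling L
  out : ∀ {P c p} → (∃ λ w → Star (ClusterStep P φ η c) p w × φ w ≡ c) →
        ∃ λ w → Star (ClusterStep P φ η c) p w × ClusterIn P φ c w × φ w ≡ c
  out (w , ws , e) = w , ws , inj₂ e , e

Around : ∀ {m} → Q m → (Q m → Set) → Set
Around o P = ∃ λ p → p ≢ o × (∀ {q} → P q → q ≡ o ⊎ q ≡ p)

-- The disjoint paths need a start other than the centre, so a neighbour stands in when `q` is the
-- centre itself.
around : ∀ {m} {P : Q (suc m) → Set} o q → (∀ {x} → P x → x ≡ o ⊎ x ≡ q) → Around o P
around o q h with q ≟ o
... | no q≢o   = q , q≢o , h
... | yes refl = o ⊕ zero , ⊕-≢ o zero , λ x∈ → [ inj₁ , inj₁ ]′ (h x∈)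

centre-solution : ∀ {m} {φ : Q m → Fin m} {P} o → Rainbow φ o → Around o P → Solution φ P
centre-solution {φ = φ} {P} o r (p , p≢o , P⊆) = record
  { ψ = ψ ; η = η ; η-sym = λ _ _ → refl
  ; leave = λ p∈ c → o ⊕ proj₁ (r c) , to-exit c p∈ , ex-in c , proj₂ (r c) }
  where
  open Centre P φ o p p≢o P⊆ (proj₁ ∘ r) (proj₂ ∘ r) (λ c → o ⊕ proj₁ (r c)) (λ _ → inj₁ refl)

-- Labels on the clusters that avoid S

label-list : ∀ {A : Set} → DecidableEquality A → ∀ n (ys : List A) → Unique ys → suc n ≤ length ys →
             ∃ λ (L : A → Fin (suc n)) → ∀ c → ∃ λ y → y ∈ ys × L y ≡ c
label-list _ zero (y ∷ _) _ _ = (λ _ → zero) , λ { zero → y , here refl , refl }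
label-list {A} _≟A_ (suc n) (y ∷ ys) (y∉ ∷ u) (s≤s le) with label-list _≟A_ n ys u le
... | L , onto = L′ , onto′
  where
  L′ : A → Fin (suc (suc n))
  L′ w = pick (w ≟A y) zero (suc (L w))
  onto′ : ∀ c → ∃ λ w → w ∈ y ∷ ys × L′ w ≡ c
  onto′ zero = y , here refl , pick-yes (y ≟A y) refl
  onto′ (suc c) with onto c
  ... | w , w∈ , e = w , there w∈ , trans (pick-no (w ≟A y) (All.lookup y∉ w∈ ∘ sym)) (cong suc e)

without : ∀ {A : Set} → DecidableEquality A → ∀ z (ys : List A) → Unique ys →
  ∃ λ ys′ → Unique ys′ × length ys ≤ suc (length ys′) × z ∉ ys′ × (∀ {y} → y ∈ ys′ → y ∈ ys)
without _ z [] _ = [] , [] , z≤n , (λ ()) , id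
without _≟A_ z (y ∷ ys) (y∉ ∷ u) with y ≟A z | without _≟A_ z ys u
... | yes refl | _ = ys , u , s≤s ≤-refl , (λ z∈ → All.lookup y∉ z∈ refl) , there
... | no y≢z | ys′ , u′ , le , z∉ , sub = y ∷ ys′ ,
  All.tabulate (λ x∈ → All.lookup y∉ (sub x∈)) ∷ u′ , s≤s le ,
  (λ { (here e) → y≢z (sym e) ; (there z∈) → z∉ z∈ }) ,
  λ { (here e) → here e ; (there x∈) → there (sub x∈) }

without-all : ∀ {A : Set} → DecidableEquality A → ∀ zs {n} (ys : List A) → Unique ys →
  length zs + n ≤ length ys →
  ∃ λ ys′ → Unique ys′ × n ≤ length ys′ × (∀ {y} → y ∈ ys′ → y ∈ ys × y ∉ zs)
without-all _ [] ys u le = ys , u , le , λ y∈ → y∈ , λ ()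
without-all _≟A_ (z ∷ zs) ys u le with without _≟A_ z ys u
... | ys₁ , u₁ , le₁ , z∉ , sub with without-all _≟A_ zs ys₁ u₁ (≤-pred (≤-trans le le₁))
...   | ys₂ , u₂ , le₂ , out = ys₂ , u₂ , le₂ , λ y∈ → sub (proj₁ (out y∈)) ,
  λ { (here refl) → z∉ (proj₁ (out y∈)) ; (there y∈zs) → proj₂ (out y∈) y∈zs }

-- A linear bound on the size of the cube is enough: dropping the clusters of four points leaves at
-- least 4 + m, and 3 + m colours are to be placed.
many : ∀ m → ∃ λ (ys : List (Q (3 + m))) → Unique ys × 8 + m ≤ length ys
many zero = ys , toWitness {a? = unique? _≟_ ys} _ , ≤-refl
  where
  ys : List (Q 3)
  ys = (false ∷ false ∷ false ∷ []) ∷ (false ∷ false ∷ true ∷ []) ∷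
       (false ∷ true  ∷ false ∷ []) ∷ (false ∷ true  ∷ true ∷ []) ∷
       (true  ∷ false ∷ false ∷ []) ∷ (true  ∷ false ∷ true ∷ []) ∷
       (true  ∷ true  ∷ false ∷ []) ∷ (true  ∷ true  ∷ true ∷ []) ∷ []
many (suc m) with many m
... | ys , u , le = (true ∷ Vec.replicate _ false) ∷ map (false ∷_) ys ,
  All.tabulate (λ y∈ e → new (∈-map⁻ _ y∈) e) ∷ Unique.map⁺ (λ { refl → refl }) u ,
  s≤s (subst (8 + m ≤_) (sym (length-map _ ys)) le)
  where
  new : ∀ {y} → (∃ λ x → x ∈ ys × y ≡ false ∷ x) → true ∷ Vec.replicate (3 + m) false ≢ y
  new (_ , _ , refl) ()

spare-labels : ∀ {m} (zs : List (Q (3 + m))) → length zs ≡ 4 →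
  ∃ λ (L : Q (3 + m) → Fin (3 + m)) → ∀ c → ∃ λ y → y ∉ zs × L y ≡ c
spare-labels {m} zs len with many m
... | ys , u , le with without-all _≟_ zs {3 + m} ys u
                         (≤-trans (subst (λ l → l + (3 + m) ≤ 8 + m) (sym len) (m≤n⇒m≤1+n ≤-refl)) le)
...   | ys′ , u′ , le′ , out with label-list _≟_ (2 + m) ys′ u′ le′
...     | L , onto = L , λ c → proj₁ (onto c) , proj₂ (out (proj₁ (proj₂ (onto c)))) , proj₂ (proj₂ (onto c))

-- Three routing schemes

module _ {m : ℕ} where

  private
    M : ℕ
    M = suc m

  toward : Q M → Q M → Fin M
  toward o k = uncolour (direction o k)

  toward-⊕ : ∀ o c → toward o (o ⊕ c) ≡ c
  toward-⊕ o c = cong uncolour (direction-⊕ o c)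

  -- The paths in the class-true clusters are centred at b, so that the vertex (true , b , w)
  -- opposite to (false , w , b) is free to take the colour φ w.
  single-cluster : ∀ {S : List (Vertex M)} b {P} → Labelling M P →
    (∀ {p k} → (false , p , k) ∈ S → k ≡ b × P p) → (∀ {p} → P p → (false , p , b) ∈ S) →
    (∀ k → ∃ λ q → ∀ {p} → (true , p , k) ∈ S → p ≡ q) → Routing Adjacent S M
  single-cluster {S} b {P} lab inside P⊆ lone = routing hub to-hub
    where
    open Labelling lab using (φ)
    near : Solution φ (λ p → (false , p , b) ∈ S)
    near = labelled-solution ((λ p∈ → proj₂ (inside p∈)) , P⊆) lab
    labels : Q M → Q M → Fin M
    labels w k = pick (k ≟ b) (φ w) (toward b k)
    labels-⊕ : ∀ w c → labels w (b ⊕ c) ≡ c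
    labels-⊕ w c = trans (pick-no (_ ≟ b) (⊕-≢ b c)) (toward-⊕ b c)
    surround : ∀ w → Around b (λ p → (true , p , w) ∈ S)
    surround w = around b (proj₁ (lone w)) (inj₂ ∘ proj₂ (lone w))
    module Lone (w : Q M) = Centre (λ p → (true , p , w) ∈ S) (labels w) b (proj₁ (surround w))
      (proj₁ (proj₂ (surround w))) (proj₂ (proj₂ (surround w))) id (labels-⊕ w) (b ⊕_) (λ _ → inj₁ refl)
    L : Bool → Q M → Fin M
    L false = toward b
    L true  = φ
    ψ : Bool → Q M → Q M → Fin M
    ψ false k = Solution.ψ near
    ψ true  k = Lone.ψ k
    η : Bool → Q M → Q M → Fin M → Fin M
    η false k = Solution.η near
    η true  k = Lone.η k
    η-sym : ∀ s k p j → η s k (p ⊕ j) j ≡ η s k p j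
    η-sym false k = Solution.η-sym near
    η-sym true  k = λ _ _ → refl
    open Colouring S L ψ η η-sym
    open Hubs (b ⊕_) (λ c (p , p∈) → ⊕-≢ b c (proj₁ (inside p∈))) (toward-⊕ b)
    corner : ∀ {w c} → φ w ≡ c → ClusterIn (λ p → (true , p , w) ∈ S) (Lone.ψ w) c b
    corner {w} e = inj₂ (trans (Lone.ψ-centre w) (trans (pick-yes (b ≟ b) refl) e))
    to-hub : ∀ c {x} → x ∈ S → Star (Step c) x (hub c)
    to-hub c {true , p , w} x∈ =
      cluster-walk (p , x∈) (Lone.to-exit w c x∈) ◅◅ exit-true (in-cluster (p , x∈) (Lone.ex-in w c))
    to-hub c {false , p , k} x∈ with inside x∈
    ... | refl , _ with Solution.leave near x∈ c
    ...   | w , ws , i , e = cluster-walk (p , x∈) ws ◅◅ leave-at (meets? true w)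
      where
      leave-at : Dec (Meets true w) → Star (Step c) (false , w , b) (hub c)
      leave-at (no ¬h) = exit-false w ¬h e (in-cluster (p , x∈) i)
      -- The vertex across may itself be in S. The edge then has the colour `L true w`, which is
      -- `φ w` and so equals `c`.
      leave-at (yes h) =
        cross-S w e (in-cluster (p , x∈) i) (in-cluster h (corner e)) ◅
        cluster-walk h (Lone.from-centre w c (corner e)) ◅◅
        exit-true (in-cluster h (Lone.ex-in w c))

  -- Every class-true cluster is free, so any exit with label `c` works. Only the hubs must dodge S,
  -- whence the separate labels `Lf` of the class-false clusters.
  one-class : ∀ {S : List (Vertex M)} → (∀ {v} → (true , v) ∉ S) → (φ : Q M → Fin M) →
    (∀ k → Solution φ (λ p → (false , p , k) ∈ S)) →
    (∃ λ (L : Q M → Fin M) → ∀ c → ∃ λ y → ¬ (∃ λ p → (false , p , y) ∈ S) × L y ≡ c) →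
    Routing Adjacent S M
  one-class {S} none φ solve (Lf , onto) = routing hub to-hub
    where
    L : Bool → Q M → Fin M
    L false = Lf
    L true  = φ
    ψ : Bool → Q M → Q M → Fin M
    ψ _ k = Solution.ψ (solve k)
    η : Bool → Q M → Q M → Fin M → Fin M
    η _ k = Solution.η (solve k)
    open Colouring S L ψ η (λ _ k → Solution.η-sym (solve k))
    open Hubs (proj₁ ∘ onto) (proj₁ ∘ proj₂ ∘ onto) (proj₂ ∘ proj₂ ∘ onto)
    to-hub : ∀ c {x} → x ∈ S → Star (Step c) x (hub c)
    to-hub c {true , _} x∈ = contradiction x∈ none
    to-hub c {false , p , k} x∈ with Solution.leave (solve k) x∈ c
    ... | w , ws , i , e =
      cluster-walk (p , x∈) ws ◅◅ exit-false w (none ∘ proj₂) e (in-cluster (p , x∈) i)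

  -- If the direction r leads from o to a cluster meeting S, then its colour leaves at o.
  record CentreOf (S : List (Vertex M)) (s : Bool) : Set where
    field
      o       : Q M
      r       : Fin M
      cover   : ∀ k → Around o (λ p → (s , p , k) ∈ S)
      blocked : ∀ c {p} → (not s , p , o ⊕ c) ∈ S → c ≡ r × (∀ {q} → (not s , q , o) ∉ S)

  two-centres : ∀ {S : List (Vertex M)} → (∀ s → CentreOf S s) → Routing Adjacent S M
  two-centres {S} centre = routing hub to-hub
    where
    module C s = CentreOf (centre s)
    meet? : ∀ s k → Dec (∃ λ p → (s , p , k) ∈ S)
    -- The decision depends on S only. It is taken from a dummy colouring because the true one is
    -- built from `ex`, which needs it.
    meet? = Colouring.meets? S (λ _ _ → zero) (λ _ _ _ → zero) (λ _ _ _ _ → zero) (λ _ _ _ _ → refl)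
    labels : Bool → Q M → Fin M
    labels s w = pick (w ≟ C.o s) (C.r s) (toward (C.o s) w)
    labels-⊕ : ∀ s c → labels s (C.o s ⊕ c) ≡ c
    labels-⊕ s c = trans (pick-no (_ ≟ C.o s) (⊕-≢ (C.o s) c)) (toward-⊕ (C.o s) c)
    labels-o : ∀ s → labels s (C.o s) ≡ C.r s
    labels-o s = pick-yes (C.o s ≟ C.o s) refl
    ex : Bool → Fin M → Q M
    ex s c = pick (meet? (not s) (C.o s ⊕ c)) (C.o s) (C.o s ⊕ c)
    ex-at : ∀ s c → ex s c ≡ C.o s ⊕ c ⊎ (ex s c ≡ C.o s × labels s (C.o s) ≡ c)
    ex-at s c with meet? (not s) (C.o s ⊕ c)
    ... | no _        = inj₁ refl
    ... | yes (p , h) = inj₂ (refl , trans (labels-o s) (sym (proj₁ (C.blocked s c h))))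
    ex-avoids : ∀ s c → ¬ (∃ λ p → (not s , p , ex s c) ∈ S)
    ex-avoids s c with meet? (not s) (C.o s ⊕ c)
    ... | no ¬h       = ¬h
    ... | yes (p , h) = λ (q , h′) → proj₂ (C.blocked s c h) h′
    ex-label : ∀ s c → labels s (ex s c) ≡ c
    ex-label s c with ex s c | ex-at s c
    ... | _ | inj₁ refl       = labels-⊕ s c
    ... | _ | inj₂ (refl , e) = e
    module K s k = Centre (λ p → (s , p , k) ∈ S) (labels s) (C.o s) (proj₁ (C.cover s k))
      (proj₁ (proj₂ (C.cover s k))) (proj₂ (proj₂ (C.cover s k))) id (labels-⊕ s) (ex s) (ex-at s)
    -- `labels s` describes what class `s` faces, that is, the clusters of class `not s`.
    open Colouring S (labels ∘ not) K.ψ K.η (λ _ _ _ _ → refl)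
    open Hubs (ex true) (ex-avoids true) (ex-label true)
    to-hub : ∀ c {x} → x ∈ S → Star (Step c) x (hub c)
    to-hub c {true , p , k} x∈ =
      cluster-walk (p , x∈) (K.to-exit true k c x∈) ◅◅ exit-true (in-cluster (p , x∈) (K.ex-in true k c))
    to-hub c {false , p , k} x∈ =
      cluster-walk (p , x∈) (K.to-exit false k c x∈) ◅◅
      exit-false (ex false c) (ex-avoids false c) (ex-label false c) (in-cluster (p , x∈) (K.ex-in false k c))

-- At distance three from `z`: of opposite parity and yet not adjacent, which takes three
-- dimensions.
three-far : ∀ {m} → Q (3 + m) → Q (3 + m)
three-far z = z ⊕ zero ⊕ suc zero ⊕ suc (suc zero)

three-far-≢ : ∀ {m} (z : Q (3 + m)) c → three-far z ⊕ c ≢ z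
three-far-≢ (x ∷ y ∷ w ∷ r) zero          e = not-≢ (cong (Vec.head ∘ Vec.tail) e)
three-far-≢ (x ∷ y ∷ w ∷ r) (suc zero)    e = not-≢ (cong Vec.head e)
three-far-≢ (x ∷ y ∷ w ∷ r) (suc (suc c)) e = not-≢ (cong Vec.head e)

parity-three-far : ∀ {m} (z : Q (3 + m)) → parity (three-far z) ≡ not (parity z)
parity-three-far z = trans (parity-⊕ (z ⊕ zero ⊕ suc zero) (suc (suc zero)))
  (cong not (trans (parity-⊕ (z ⊕ zero) (suc zero)) (trans (cong not (parity-⊕ z zero)) (not-involutive _))))

-- No neighbour of o has the parity of o, so only a point whose parity differs from that
-- of the other two matters.
off-three : ∀ {m} (x y z : Q (3 + m)) →
            ∃ λ o → ∀ c → o ⊕ c ≢ x × o ⊕ c ≢ y × o ⊕ c ≢ z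
off-three x y z with parity x ≟ᵇ parity y | parity x ≟ᵇ parity z
... | yes xy | yes xz = x , λ c → ⊕-≢ x c , ⊕-parity-≢ c xy , ⊕-parity-≢ c xz
... | yes xy | no xz = three-far z , λ c → ⊕-parity-≢ c zx , ⊕-parity-≢ c (trans zx xy) , three-far-≢ z c
  where
  zx : parity (three-far z) ≡ parity x
  zx = trans (parity-three-far z) (sym (¬-not xz))
... | no xy | yes xz = three-far y , λ c → ⊕-parity-≢ c yx , three-far-≢ y c , ⊕-parity-≢ c (trans yx xz)
  where
  yx : parity (three-far y) ≡ parity x
  yx = trans (parity-three-far y) (sym (¬-not xy))
... | no xy | no xz = three-far x , λ c → three-far-≢ x c , ⊕-parity-≢ c xʸ , ⊕-parity-≢ c xᶻ
  where
  xʸ : parity (three-far x) ≡ parity y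
  xʸ = trans (parity-three-far x) (sym (¬-not (xy ∘ sym)))
  xᶻ : parity (three-far x) ≡ parity z
  xᶻ = trans (parity-three-far x) (sym (¬-not (xz ∘ sym)))

-- Case analysis over classes and clusters

-- A point (p , k) is the position p in the cluster k.
Point : ℕ → Set
Point m = Q m × Q m

one-per-key : ∀ {m} (g : List (Point m)) → Unique (map proj₂ g) → ∀ k → ∃ λ q → ∀ {p} → (p , k) ∈ g → p ≡ q
-- An arbitrary position for a cluster without points.
one-per-key [] _ k = k , λ ()
one-per-key ((q , k′) ∷ g) (k′∉ ∷ u) k with k ≟ k′ | one-per-key g u k
... | yes refl | _ = q , λ
  { (here refl) → refl
  ; (there p∈) → contradiction refl (All.lookup k′∉ (∈-map⁺ proj₂ p∈)) }
... | no k≢k′ | q′ , h = q′ , λ { (here refl) → contradiction refl k≢k′ ; (there p∈) → h p∈ }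

Same : ∀ {m} → Q m → List (Point m) → Set
Same k f = All (λ x → proj₂ x ≡ k) f

same-unique : ∀ {m} {k : Q m} f → Same k f → Unique f → Unique (map proj₁ f)
same-unique [] _ _ = []
same-unique ((p , _) ∷ f) (refl ∷ s) (x∉ ∷ u) = All.tabulate fresh ∷ same-unique f s u
  where
  fresh : ∀ {q} → q ∈ map proj₁ f → p ≢ q
  fresh q∈ refl with ∈-map⁻ proj₁ q∈
  ... | (q , k) , x∈ , refl with All.lookup s x∈
  ...   | refl = All.lookup x∉ x∈ refl

same-point : ∀ {m} {k : Q m} {f p} → Same k f → p ∈ map proj₁ f → (p , k) ∈ f
same-point s p∈ with ∈-map⁻ proj₁ p∈
... | (q , k) , x∈ , refl with All.lookup s x∈
...   | refl = x∈

length-positions : ∀ {m n} (f : List (Point m)) → length f ≡ n → length (map proj₁ f) ≡ n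
length-positions f e = trans (length-map proj₁ f) e

record Classes {m} (S : List (Vertex m)) (f t : List (Point m)) : Set where
  field
    F : (λ v → (false , v) ∈ S) ≐ (_∈ f)
    T : (λ v → (true , v) ∈ S) ≐ (_∈ t)

module _ {m : ℕ} {S : List (Vertex (3 + m))} where

  private
    M : ℕ
    M = 3 + m

  F-↭ : ∀ {f f′ t} → f ↭ f′ → Classes S f t → Classes S f′ t
  F-↭ p C = record { F = ≐-↭ p (Classes.F C) ; T = Classes.T C }

  same-cluster : ∀ {f t k} → Classes S f t → Same k f → Labelling M (_∈ map proj₁ f) →
                 Unique (map proj₂ t) → Routing Adjacent S M
  same-cluster {f} {t} {k} C s lab u = single-cluster k lab inside (proj₂ F ∘ same-point s)
    (λ κ → proj₁ (one-per-key t u κ) , proj₂ (one-per-key t u κ) ∘ proj₁ T)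
    where
    open Classes C
    inside : ∀ {p κ} → (false , p , κ) ∈ S → κ ≡ k × p ∈ map proj₁ f
    inside x∈ = All.lookup s (proj₁ F x∈) , ∈-map⁺ proj₁ (proj₁ F x∈)

  module _ {f} (C : Classes S f []) (len : length f ≡ 4) where

    open Classes C

    pure : (φ : Q M → Fin M) → (∀ k → Solution φ (λ p → (false , p , k) ∈ S)) → Routing Adjacent S M
    pure φ solve = one-class none φ solve spare
      where
      none : ∀ {v} → (true , v) ∉ S
      none v∈ with proj₁ T v∈
      ... | ()
      spare : ∃ λ (L : Q M → Fin M) → ∀ c → ∃ λ y → ¬ (∃ λ p → (false , p , y) ∈ S) × L y ≡ c
      spare with spare-labels (map proj₂ f) (trans (length-map proj₂ f) len)
      ... | L , onto = L , λ c → proj₁ (onto c) ,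
        (λ (p , x∈) → proj₁ (proj₂ (onto c)) (∈-map⁺ proj₂ (proj₁ F x∈))) , proj₂ (proj₂ (onto c))

  -- The position of the first point is the centre in every cluster. Only the other three need
  -- distinct clusters; one of them may share the cluster of the first.
  pure-apart : ∀ {o k g} → Classes S ((o , k) ∷ g) [] → length g ≡ 3 → Unique (map proj₂ g) →
               Routing Adjacent S M
  pure-apart {o} {k} {g} C len u = pure C (cong suc len) (proj₁ rainbow) λ κ →
    centre-solution o (proj₁ (proj₂ rainbow)) (around o (proj₁ (one-per-key g u κ)) (cover κ))
    where
    open Classes C
    rainbow = rainbow-two o o
    cover : ∀ κ {p} → (false , p , κ) ∈ S → p ≡ o ⊎ p ≡ proj₁ (one-per-key g u κ)
    cover κ x∈ with proj₁ F x∈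
    ... | here refl = inj₁ refl
    ... | there x∈g = inj₂ (proj₂ (one-per-key g u κ) x∈g)

  pure-2-2 : ∀ {p₁ p₂ p₃ p₄ k k′} → k ≢ k′ →
    Classes S ((p₁ , k) ∷ (p₂ , k) ∷ (p₃ , k′) ∷ (p₄ , k′) ∷ []) [] → Routing Adjacent S M
  pure-2-2 {p₁} {p₂} {p₃} {p₄} {k} {k′} k≢k′ C = pure C refl (proj₁ rainbow) solve
    where
    open Classes C
    rainbow = rainbow-two p₁ p₃
    first : ∀ {p} → (false , p , k) ∈ S → p ≡ p₁ ⊎ p ≡ p₂
    first x∈ with proj₁ F x∈
    ... | here refl                         = inj₁ refl
    ... | there (here refl)                 = inj₂ refl
    ... | there (there (here refl))         = contradiction refl k≢k′
    ... | there (there (there (here refl))) = contradiction refl k≢k′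
    second : ∀ {κ} → κ ≢ k → ∀ {p} → (false , p , κ) ∈ S → p ≡ p₃ ⊎ p ≡ p₄
    second κ≢k x∈ with proj₁ F x∈
    ... | here refl                         = contradiction refl κ≢k
    ... | there (here refl)                 = contradiction refl κ≢k
    ... | there (there (here refl))         = inj₁ refl
    ... | there (there (there (here refl))) = inj₂ refl
    solve : ∀ κ → Solution (proj₁ rainbow) (λ p → (false , p , κ) ∈ S)
    solve κ with κ ≟ k
    ... | yes refl = centre-solution p₁ (proj₁ (proj₂ rainbow)) (around p₁ p₂ first)
    ... | no κ≢k   = centre-solution p₃ (proj₂ (proj₂ rainbow)) (around p₃ p₄ (second κ≢k))

  pure-3-1 : ∀ {p k′ k g} → k′ ≢ k → Classes S ((p , k′) ∷ g) [] → Same k g → length g ≡ 3 → Unique g →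
             Routing Adjacent S M
  pure-3-1 {p} {k′} {k} {g} k′≢k C s len u
    with three (map proj₁ g) (same-unique g s u) (length-positions g len)
  ... | lab , o , rainbow = pure C (cong suc len) (Labelling.φ lab) solve
    where
    open Classes C
    to : ∀ {q} → (false , q , k) ∈ S → q ∈ map proj₁ g
    to x∈ with proj₁ F x∈
    ... | here refl = contradiction refl k′≢k
    ... | there x∈g = ∈-map⁺ proj₁ x∈g
    lone : ∀ {κ} → κ ≢ k → ∀ {q} → (false , q , κ) ∈ S → q ≡ p
    lone κ≢k x∈ with proj₁ F x∈
    ... | here refl = refl
    ... | there x∈g = contradiction (All.lookup s x∈g) κ≢k
    solve : ∀ κ → Solution (Labelling.φ lab) (λ q → (false , q , κ) ∈ S)
    solve κ with κ ≟ k
    ... | yes refl = labelled-solution (to , proj₂ F ∘ there ∘ same-point s) lab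
    ... | no κ≢k   = centre-solution o rainbow (around o p (inj₂ ∘ lone κ≢k))

  pure-pair : ∀ {p₁ p₂ p₃ p₄ k₁ k₂ k} →
    let f = (p₁ , k₁) ∷ (p₂ , k₂) ∷ (p₃ , k) ∷ (p₄ , k) ∷ [] in
    Classes S f [] → Unique f → Routing Adjacent S M
  pure-pair {p₁} {p₂} {p₃} {p₄} {k₁} {k₂} {k} C u with k₁ ≟ k | k₂ ≟ k | k₁ ≟ k₂
  ... | yes refl | yes refl | _ = same-cluster C s (four _ (same-unique _ s u) refl) []
    where
    s : Same k ((p₁ , k) ∷ (p₂ , k) ∷ (p₃ , k) ∷ (p₄ , k) ∷ [])
    s = refl ∷ refl ∷ refl ∷ refl ∷ []
  ... | yes refl | no k₂≢k | _ =
    pure-3-1 k₂≢k (F-↭ p C) (refl ∷ refl ∷ refl ∷ []) refl (tail-unique (Unique-↭ p u))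
    where
    p = swap (p₁ , k) (p₂ , k₂) Permutation.refl
    tail-unique : ∀ {A : Set} {x : A} {xs} → Unique (x ∷ xs) → Unique xs
    tail-unique (_ ∷ u) = u
  pure-pair C (_ ∷ u) | no k₁≢k | yes refl | _ = pure-3-1 k₁≢k C (refl ∷ refl ∷ refl ∷ []) refl u
  pure-pair C u | no k₁≢k | no k₂≢k | yes refl = pure-2-2 k₁≢k C
  pure-pair C u | no k₁≢k | no k₂≢k | no k₁≢k₂ =
    pure-apart (F-↭ (++-comm (_ ∷ _ ∷ []) (_ ∷ _ ∷ [])) C) refl
      ((k₁≢k ∘ sym ∷ k₂≢k ∘ sym ∷ []) ∷ (k₁≢k₂ ∷ []) ∷ [] ∷ [])

  -- Either the last three points lie in distinct clusters, or two of them share one and are moved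
  -- to the end.
  route-4-0 : ∀ {f} → Classes S f [] → Unique f → length f ≡ 4 → Routing Adjacent S M
  route-4-0 {(p₁ , k₁) ∷ (p₂ , k₂) ∷ (p₃ , k₃) ∷ (p₄ , k₄) ∷ []} C u refl with k₂ ≟ k₃ | k₂ ≟ k₄ | k₃ ≟ k₄
  ... | no ≢₂₃ | no ≢₂₄ | no ≢₃₄ = pure-apart C refl ((≢₂₃ ∷ ≢₂₄ ∷ []) ∷ (≢₃₄ ∷ []) ∷ [] ∷ [])
  ... | _ | _ | yes refl = pure-pair C u
  ... | _ | yes refl | no _ = pure-pair (F-↭ p C) (Unique-↭ p u)
    where
    p = prep (p₁ , k₁) (swap (p₂ , k₂) (p₃ , k₃) Permutation.refl)
  ... | yes refl | no _ | no _ = pure-pair (F-↭ p C) (Unique-↭ p u)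
    where
    p = prep (p₁ , k₁) (shift (p₄ , k₄) ((p₂ , k₂) ∷ (p₃ , k₃) ∷ []) [])

  module _ {s : Bool} {g : List (Point M)} (u : Unique (map proj₂ g)) where

    cover : ∀ {o} → (∀ {p k} → (s , p , k) ∈ S → p ≡ o ⊎ (p , k) ∈ g) →
            ∀ k → Around o (λ p → (s , p , k) ∈ S)
    cover {o} h k = around o (proj₁ (one-per-key g u k))
      λ x∈ → [ inj₁ , inj₂ ∘ proj₂ (one-per-key g u k) ]′ (h x∈)

    -- The centre may be the position of a point of S, so a cluster may hold that point besides one
    -- of `g`. In return the other class meets only the cluster `z`; if `z` is next to `o`, the
    -- blocked colour leaves at `o`, which differs from `z`.
    centre-at : ∀ o z → (∀ {p k} → (s , p , k) ∈ S → p ≡ o ⊎ (p , k) ∈ g) →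
                (∀ {p k} → (not s , p , k) ∈ S → k ≡ z) → CentreOf S s
    centre-at o z h only with neighbour? o z
    ... | yes (j , z≡) = record { o = o ; r = j ; cover = cover h ; blocked = λ c x∈ →
      ⊕-injective o (trans (only x∈) z≡) , λ y∈ → ⊕-≢ o j (sym (trans (only y∈) z≡)) }
    ... | no ¬e = record { o = o ; r = zero ; cover = cover h ; blocked = λ c x∈ →
      contradiction (c , sym (only x∈)) ¬e }

    -- With at most one point in each cluster the centre can be chosen freely, so it is placed where
    -- no neighbour faces a cluster meeting S.
    centre-off : ∀ x y z → (∀ {p k} → (s , p , k) ∈ S → (p , k) ∈ g) →
                 (∀ {p k} → (not s , p , k) ∈ S → k ∈ x ∷ y ∷ z ∷ []) → CentreOf S s
    centre-off x y z h among with off-three x y z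
    ... | o , off = record { o = o ; r = zero ; cover = cover (inj₂ ∘ h) ; blocked = λ c w∈ →
      contradiction (among w∈) λ
        { (here e)                 → proj₁ (off c) e
        ; (there (here e))         → proj₁ (proj₂ (off c)) e
        ; (there (there (here e))) → proj₂ (proj₂ (off c)) e } }

  key-at : ∀ {z : Point M} {k p} → (p , k) ∈ z ∷ [] → k ≡ proj₂ z
  key-at (here refl) = refl

  route-3-1-apart : ∀ {x₁ x₂ x₃ y} → Classes S (x₁ ∷ x₂ ∷ x₃ ∷ []) (y ∷ []) → proj₂ x₂ ≢ proj₂ x₃ →
                    Routing Adjacent S M
  route-3-1-apart {x₁} {x₂} {x₃} {y} C ne = two-centres λ
    { false → centre-at ((ne ∷ []) ∷ [] ∷ []) (proj₁ x₁) (proj₂ y)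
        (λ x∈ → [ (λ { refl → inj₁ refl }) , inj₂ ]′ (uncons∈ (proj₁ F x∈))) (key-at ∘ proj₁ T)
    ; true  → centre-off ([] ∷ []) (proj₂ x₁) (proj₂ x₂) (proj₂ x₃) (proj₁ T) (∈-map⁺ proj₂ ∘ proj₁ F) }
    where
    open Classes C
    uncons∈ : ∀ {x y : Point M} {l} → x ∈ y ∷ l → x ≡ y ⊎ x ∈ l
    uncons∈ (here e)  = inj₁ e
    uncons∈ (there i) = inj₂ i

  route-3-1 : ∀ {f t} → Classes S f t → Unique f → length f ≡ 3 → length t ≡ 1 → Routing Adjacent S M
  route-3-1 {(p₁ , k₁) ∷ (p₂ , k₂) ∷ (p₃ , k₃) ∷ []} {y ∷ []} C u refl refl with k₂ ≟ k₃ | k₁ ≟ k₃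
  ... | no k₂≢k₃ | _        = route-3-1-apart C k₂≢k₃
  ... | yes _    | no k₁≢k₃ = route-3-1-apart (F-↭ (swap _ _ Permutation.refl) C) k₁≢k₃
  ... | yes refl | yes refl = same-cluster C s (proj₁ (three _ (same-unique _ s u) refl)) ([] ∷ [])
    where
    s : Same k₁ ((p₁ , k₁) ∷ (p₂ , k₁) ∷ (p₃ , k₁) ∷ [])
    s = refl ∷ refl ∷ refl ∷ []

  two-classes-same : ∀ {x₁ x₂ y₁ y₂ : Point M} → Classes S (x₁ ∷ x₂ ∷ []) (y₁ ∷ y₂ ∷ []) →
    proj₂ x₁ ≡ proj₂ x₂ → proj₂ y₁ ≡ proj₂ y₂ → Routing Adjacent S M
  two-classes-same {x₁} {x₂} {y₁} {y₂} C ex ey = two-centres λ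
    { false → centre-at ([] ∷ []) (proj₁ x₁) (proj₂ y₁) (head-or-tail ∘ proj₁ F) (one-key (sym ey) ∘ proj₁ T)
    ; true  → centre-at ([] ∷ []) (proj₁ y₁) (proj₂ x₁) (head-or-tail ∘ proj₁ T) (one-key (sym ex) ∘ proj₁ F) }
    where
    open Classes C
    head-or-tail : ∀ {x y : Point M} {p k} → (p , k) ∈ x ∷ y ∷ [] → p ≡ proj₁ x ⊎ (p , k) ∈ y ∷ []
    head-or-tail (here refl) = inj₁ refl
    head-or-tail (there x∈)  = inj₂ x∈
    one-key : ∀ {x y : Point M} {p k} → proj₂ y ≡ proj₂ x → (p , k) ∈ x ∷ y ∷ [] → k ≡ proj₂ x
    one-key e (here refl)         = refl
    one-key e (there (here refl)) = e

  two-classes-apart : ∀ {x₁ x₂ y₁ y₂ : Point M} → Classes S (x₁ ∷ x₂ ∷ []) (y₁ ∷ y₂ ∷ []) →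
    proj₂ x₁ ≢ proj₂ x₂ → proj₂ y₁ ≢ proj₂ y₂ → Routing Adjacent S M
  two-classes-apart {x₁} {x₂} {y₁} {y₂} C nx ny = two-centres λ
    { false → centre-off ((nx ∷ []) ∷ [] ∷ []) (proj₂ y₁) (proj₂ y₂) (proj₂ y₂) (proj₁ F) (among ∘ proj₁ T)
    ; true  → centre-off ((ny ∷ []) ∷ [] ∷ []) (proj₂ x₁) (proj₂ x₂) (proj₂ x₂) (proj₁ T) (among ∘ proj₁ F) }
    where
    open Classes C
    among : ∀ {x y : Point M} {p k} → (p , k) ∈ x ∷ y ∷ [] → k ∈ proj₂ x ∷ proj₂ y ∷ proj₂ y ∷ []
    among (here refl)         = here refl
    among (there (here refl)) = there (here refl)

  two-classes-mixed : ∀ {p₁ p₂ k} {y₁ y₂ : Point M} → let f = (p₁ , k) ∷ (p₂ , k) ∷ [] in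
    Classes S f (y₁ ∷ y₂ ∷ []) → Unique f → proj₂ y₁ ≢ proj₂ y₂ → Routing Adjacent S M
  two-classes-mixed {p₁} {p₂} {k} C ((x≢ ∷ []) ∷ _) ny =
    same-cluster {k = k} C (refl ∷ refl ∷ []) (two (id , id) λ { refl → x≢ refl }) ((ny ∷ []) ∷ [] ∷ [])

-- Exchanging the two classes

exchange : ∀ {m} → Vertex m → Vertex m
exchange (s , v) = not s , v

exchange-involutive : ∀ {m} (v : Vertex m) → exchange (exchange v) ≡ v
exchange-involutive (s , v) = cong (_, v) (not-involutive s)

exchange-adjacent : ∀ {m} {u v : Vertex m} → Adjacent (exchange u) (exchange v) → Adjacent u v
exchange-adjacent {u = s , p , k} {v} (i , e) =
  i , trans (sym (exchange-involutive v)) (trans (cong exchange e) (commute i))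
  where
  commute : ∀ i → exchange (neighbour (not s , p , k) i) ≡ neighbour (s , p , k) i
  commute zero    = cong (λ s → not s , k , p) (not-involutive s)
  commute (suc j) = cong (λ s → s , p ⊕ j , k) (not-involutive s)

module _ {m : ℕ} {S : List (Vertex (3 + m))} where

  exchange-classes : ∀ {f t} → Classes S f t → Classes (map exchange S) t f
  exchange-classes C = record
    { F = (λ x∈ → proj₁ T (back {s = true} x∈)) , λ x∈ → ∈-map⁺ exchange (proj₂ T x∈)
    ; T = (λ x∈ → proj₁ F (back {s = false} x∈)) , λ x∈ → ∈-map⁺ exchange (proj₂ F x∈) }
    where
    open Classes C
    back : ∀ {s v} → exchange (s , v) ∈ map exchange S → (s , v) ∈ S
    back = ∈-map-injective exchange exchange exchange-involutive

  -- Changing the class of every vertex is an automorphism, so class false may be assumed to have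
  -- the most points, or to be the class whose two points share a cluster.
  unexchange : ∀ {k} → Routing Adjacent (map exchange S) k → Routing Adjacent S k
  unexchange = Routing-transport exchange exchange exchange-involutive exchange-involutive exchange-adjacent

  route-2-2 : ∀ {f t} → Classes S f t → Unique f → Unique t → length f ≡ 2 → length t ≡ 2 →
              Routing Adjacent S (3 + m)
  route-2-2 {(p₁ , k₁) ∷ (p₂ , k₂) ∷ []} {(q₁ , l₁) ∷ (q₂ , l₂) ∷ []} C u u′ refl refl with k₁ ≟ k₂ | l₁ ≟ l₂
  ... | yes k≡   | yes l≡   = two-classes-same C k≡ l≡
  ... | no k≢    | no l≢    = two-classes-apart C k≢ l≢
  ... | yes refl | no l≢    = two-classes-mixed C u l≢
  ... | no k≢    | yes refl = unexchange (two-classes-mixed (exchange-classes C) u′ k≢)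

vertex-injective : ∀ {m} {s s′ : Bool} {v v′ : Point m} → (s , v) ≡ (s′ , v′) → s ≡ s′ × v ≡ v′
vertex-injective refl = refl , refl

vertex-split : ∀ {m} (u : Vertex m) → ∃₂ λ (s : Bool) (v : Point m) → u ≡ (s , v)
vertex-split (s , v) = s , v , refl

module ClassBit {m : ℕ} = Parts {Point m} {Vertex m} _,_ vertex-injective vertex-split

route : ∀ {m} (S : List (Vertex (3 + m))) → Unique S → length S ≡ 4 → Routing Adjacent S (3 + m)
route S u len = cases (part false) (part true) refl refl (trans size len)
  where
  open ClassBit.Split (ClassBit.split S u)
  C : Classes S (part false) (part true)
  C = record { F = part⇔ false ; T = part⇔ true }
  cases : ∀ f t → part false ≡ f → part true ≡ t → length f + length t ≡ 4 → Routing Adjacent S _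
  cases f [] ef et e = route-4-0 (subst (Classes S _) et C) (unique false)
    (trans (cong length ef) (trans (sym (+-identityʳ _)) e))
  cases [] t ef et e = unexchange (route-4-0 (subst (Classes _ _) ef (exchange-classes C)) (unique true)
    (trans (cong length et) e))
  cases (_ ∷ []) t ef et e = unexchange (route-3-1 (exchange-classes C) (unique true)
    (trans (cong length et) (cong pred e)) (cong length ef))
  cases (_ ∷ _ ∷ []) t ef et e = route-2-2 C (unique false) (unique true) (cong length ef)
    (trans (cong length et) (cong (pred ∘ pred) e))
  cases (_ ∷ _ ∷ _ ∷ []) (_ ∷ []) ef et e = route-3-1 C (unique false) (cong length ef) (cong length et)
  cases (_ ∷ _ ∷ _ ∷ []) (_ ∷ _ ∷ _) _ _ ()
  cases (_ ∷ _ ∷ _ ∷ _ ∷ []) (_ ∷ _) _ _ ()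
  cases (_ ∷ _ ∷ _ ∷ _ ∷ _ ∷ _) (_ ∷ _) _ _ ()

-- Return to the bit strings, and the set attaining the minimum

packing : ∀ {m} (S : List (DVert (4 + m))) → Unique S → length S ≡ 4 →
          InternallyDisjointSTrees (DAdj (4 + m)) S (3 + m)
packing {m} S@(_ ∷ _) u len = Routing⇒trees _≟_
  (Routing-transport {AdjV = Adjacent} {AdjW = DAdj (4 + m)}
    (encode {M}) decode (encode-decode {M}) decode-encode (λ {u} {v} → adjacent {u} {v})
    {S} (route (map decode S) unique (trans (length-map (decode {M}) S) len)))
  where
  M : ℕ
  M = 3 + m
  adjacent : ∀ {u v} → Adjacent (decode {M} u) (decode v) → DAdj (4 + m) u v
  adjacent {u} {v} a = subst₂ (DAdj (4 + m)) (encode-decode {M} u) (encode-decode {M} v)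
    (encode-adjacent {M} {decode u} {decode v} a)
  unique : Unique (map (decode {M}) S)
  unique = Unique.map⁺ (λ {u} {v} → decode-injective {M} {u} {v}) u

theorem11 : (n : ℕ) → n ≥ 4 → κr≡ (DAdj n) 4 (n ∸ 1)
theorem11 (suc (suc (suc (suc m)))) (s≤s (s≤s (s≤s (s≤s z≤n)))) =
  packing , map encode S , unique , refl , packing (map encode S) unique refl ,
  λ T → no-full-packing {3 + m} T (here refl) (there (here refl)) (there (there (here refl)))
    (distinct {x} {y} λ ()) (distinct {z} {x} λ ()) (distinct {z} {y} λ ())
    (encode-adjacent {3 + m} {x} {y} (zero , refl))
  where
  o : Q (3 + m)
  o = Vec.replicate (3 + m) false
  -- The upper bound needs an edge within the set, here `x` to `y` between the classes, and a third
  -- point `z` that the tree through this edge cannot reach; `w` completes the four.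
  x y z w : Vertex (3 + m)
  x = false , o , o
  y = true , o , o
  z = false , o ⊕ zero , o
  w = true , o ⊕ zero , o
  S : List (Vertex (3 + m))
  S = x ∷ y ∷ z ∷ w ∷ []
  S-unique : Unique S
  S-unique = ((λ ()) ∷ (λ ()) ∷ (λ ()) ∷ []) ∷ ((λ ()) ∷ (λ ()) ∷ []) ∷ ((λ ()) ∷ []) ∷ [] ∷ []
  unique : Unique (map encode S)
  unique = Unique.map⁺ (encode-injective {3 + m}) S-unique
  distinct : ∀ {u v : Vertex (3 + m)} → u ≢ v → encode u ≢ encode v
  distinct ne = ne ∘ encode-injective
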